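{- Let $H$ be a digital $2$-manifold. Suppose that for every digital $2$-manifold $K$ equivalent to $H$ (including $K=H$), any digital $1$-sphere $S$ belonging to $K$ is the boundary of some digital $2$-disk $D$ belonging to $K$. Then $H$ is a digital $2$-sphere.
   Context: A digital space is a finite simple undirected graph, its vertices are called points; a subspace is an induced subgraph, and a sphere or disk "belongs to" $K$ if it is an induced subgraph of $K$. For a point $v$, the rim $O(v)$ is the subspace induced on the neighbours of $v$; $O(v,u)=O(v)\cap O(u)$. The family $T$ of contractible graphs is defined inductively: the one-point graph $K(1)$ belongs to $T$, and $T$ consists of all graphs obtained from $K(1)$ by finite sequences of the following contractible transformations: deleting a point $v$ with $O(v)\in T$; adding a new point $v$ so that its rim is an induced subgraph $H\in T$; deleting an edge $(v,u)$ with $O(v,u)\in T$; adding an edge between non-adjacent points $v,u$ with $O(v,u)\in T$. A digital $0$-disk is a single point; a digital $0$-sphere is the graph consisting of two non-adjacent points. A digital $1$-sphere is a connected graph in which the rim of every point is a $0$-sphere; a digital $1$-disk is a $1$-sphere with one point deleted (its boundary is the pair of endpoints). For $n=2$: a digital $2$-disk is a connected contractible graph $D$ that is a disjoint union $D=\partial D\cup\mathrm{Int}D$ of two nonempty subspaces such that the rim (in $D$) of each point of $\partial D$ is a digital $1$-disk, the rim of each point of $\mathrm{Int}D$ is a digital $1$-sphere, and the boundary $\partial D$ is a digital $1$-sphere; a digital $2$-sphere is a graph $D\#C$ obtained from two digital $2$-disks $D,C$ with isomorphic boundaries by identifying each point of $\partial D$ with its counterpart in $\partial C$. A digital $2$-manifold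 is a connected graph in which the rim of every point is a digital $1$-sphere. d-Transformations of a digital $2$-manifold $N$: (i) if $D$ is a digital $2$-disk belonging to $N$ and $v\in\mathrm{Int}D$, delete all points of $\mathrm{Int}D$ except $v$ and join $v$ to every point of $\partial D$; (ii) if $v$ is a point of $N$ and $D$ is a digital $2$-disk disjoint from $N$ with $\partial D$ isomorphic to $O(v)$, identify each point of $\partial D$ with its counterpart in $O(v)$ and delete $v$. Two digital $2$-manifolds are equivalent if one can be obtained from the other by a sequence of d-transformations. -}

module Defs where

open import Level using (0ℓ)
open import Data.Nat using (ℕ; _+_)
open import Data.Fin using (Fin; zero; suc; _↑ˡ_; splitAt; _≟_)
open import Data.Fin.Properties using (any?)
open import Data.Fin.Subset
  using (Subset; inside; outside; _∈_; _⊆_; _∩_; _─_; _-_; ∁; ⁅_⁆; ∣_∣; Nonempty)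
open import Data.Fin.Subset.Properties using (_∈?_)
open import Data.Vec using (_∷_; lookup; tabulate)
open import Data.Product using (_×_; _,_; ∃-syntax)
open import Data.Sum using (_⊎_; inj₁; inj₂)
import Data.Sum as Sum
open import Data.Empty using (⊥)
open import Function using (_↔_; _⇔_; Inverse)
open import Relation.Nullary using (¬_; Dec; no; does)
open import Relation.Nullary.Decidable using (_×-dec_; _⊎-dec_; ¬?)
open import Relation.Binary using (Rel; Symmetric; Irreflexive; Decidable)
open import Relation.Binary.PropositionalEquality using (_≡_; _≢_; refl; ≢-sym)
open import Relation.Binary.Construct.Closure.ReflexiveTransitive using (Star)

record Graph : Set₁ where
  infix 4 _~_ _~?_
  field
    order  : ℕ
    _~_    : Rel (Fin order) 0ℓ
    _~?_   : Decidable _~_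
    ~-sym  : Symmetric _~_
    ~-irr  : Irreflexive _≡_ _~_

  Point : Set
  Point = Fin order

  neighbours : Point → Subset order
  neighbours v = tabulate λ u → does (v ~? u)

  -- The empty graph does not count as connected.
  Connected : Set
  Connected = Point × (∀ x y → Star _~_ x y)

open Graph using (order; Point; neighbours; Connected)

infix 4 _≅_
record _≅_ (G H : Graph) : Set where
  private
    module G = Graph G
    module H = Graph H
  field
    points : G.Point ↔ H.Point
  open Inverse points public using (to; from)
  field
    edges : ∀ x y → (x G.~ y) ⇔ (to x H.~ to y)

-- The i-th element of p, in increasing order.
nth : ∀ {n} (p : Subset n) → Fin ∣ p ∣ → Fin n
nth (inside  ∷ p) zero    = zero
nth (inside  ∷ p) (suc i) = suc (nth p i)
nth (outside ∷ p) i       = suc (nth p i)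

-- q ∩ p, regarded as a subset of the points of the subspace induced on p.
restrict : ∀ {n} (p q : Subset n) → Subset ∣ p ∣
restrict p q = tabulate λ i → lookup q (nth p i)

induced : (G : Graph) → Subset (order G) → Graph
induced G p = record
  { order = ∣ p ∣
  ; _~_   = λ i j → nth p i ~ nth p j
  ; _~?_  = λ i j → nth p i ~? nth p j
  ; ~-sym = ~-sym
  ; ~-irr = λ { refl → ~-irr refl }
  }
  where open Graph G using (_~_; _~?_; ~-sym; ~-irr)

infixl 6 _∖_
_∖_ : (G : Graph) → Subset (order G) → Graph
G ∖ p = induced G (∁ p)

rim : (G : Graph) → Point G → Graph
rim G v = induced G (neighbours G v)

rim₂ : (G : Graph) → Point G → Point G → Graph
rim₂ G v u = induced G (neighbours G v ∩ neighbours G u)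

edgeless : ℕ → Graph
edgeless n = record
  { order = n
  ; _~_   = λ _ _ → ⊥
  ; _~?_  = λ _ _ → no λ ()
  ; ~-sym = λ ()
  ; ~-irr = λ _ ()
  }

-- The new point is zero.
addPoint : (G : Graph) → Subset (order G) → Graph
addPoint G p = record
  { order = 1 + order G
  ; _~_   = _≈_
  ; _~?_  = dec
  ; ~-sym = λ {x} {y} → symm x y
  ; ~-irr = λ { {x} refl → irr x }
  }
  where
  open Graph G using (_~_; _~?_; ~-sym; ~-irr)

  _≈_ : Rel (Fin (1 + order G)) 0ℓ
  zero  ≈ zero  = ⊥
  zero  ≈ suc y = y ∈ p
  suc x ≈ zero  = x ∈ p
  suc x ≈ suc y = x ~ y

  dec : Decidable _≈_
  dec zero    zero    = no λ ()
  dec zero    (suc y) = y ∈? p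
  dec (suc x) zero    = x ∈? p
  dec (suc x) (suc y) = x ~? y

  symm : ∀ x y → x ≈ y → y ≈ x
  symm zero    (suc y) e = e
  symm (suc x) zero    e = e
  symm (suc x) (suc y) e = ~-sym e

  irr : ∀ x → ¬ (x ≈ x)
  irr (suc x) e = ~-irr refl e

-- Join v to every point of p other than v itself.
join : (G : Graph) → Point G → Subset (order G) → Graph
join G v p = record
  { order = order G
  ; _~_   = λ x y → x ~ y ⊎ x ≢ y × (x ≡ v × y ∈ p ⊎ y ≡ v × x ∈ p)
  ; _~?_  = λ x y → x ~? y ⊎-dec
                    ¬? (x ≟ y) ×-dec ((x ≟ v ×-dec y ∈? p) ⊎-dec (y ≟ v ×-dec x ∈? p))
  ; ~-sym = Sum.map ~-sym λ { (x≢y , e) → ≢-sym x≢y , Sum.swap e }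
  ; ~-irr = λ { refl (inj₁ e) → ~-irr refl e ; refl (inj₂ (x≢x , _)) → x≢x refl }
  }
  where open Graph G using (_~_; _~?_; ~-sym; ~-irr)

addEdge : (G : Graph) → Point G → Point G → Graph
addEdge G v u = join G v ⁅ u ⁆

deleteEdge : (G : Graph) → Point G → Point G → Graph
deleteEdge G v u = record
  { order = order G
  ; _~_   = λ x y → x ~ y × ¬ (x ≡ v × y ≡ u) × ¬ (y ≡ v × x ≡ u)
  ; _~?_  = λ x y → x ~? y ×-dec ¬? (x ≟ v ×-dec y ≟ u) ×-dec ¬? (y ≟ v ×-dec x ≟ u)
  ; ~-sym = λ { (e , a , b) → ~-sym e , b , a }
  ; ~-irr = λ { refl (e , _) → ~-irr refl e }
  }
  where open Graph G using (_~_; _~?_; ~-sym; ~-irr)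

-- The graph obtained from disjoint G and D by identifying each point of the
-- subspace p of G with its counterpart under φ in the subspace q of D.  Its
-- points are those of G followed by those of D outside q; an identified pair is
-- represented by its member in G.  Edges of D inside q are not lost, since φ
-- matches them with edges of G inside p.
glue : (G : Graph) (p : Subset (order G)) (D : Graph) (q : Subset (order D)) →
       induced G p ≅ induced D q → Graph
glue G p D q φ = record
  { order = order G + ∣ ∁ q ∣
  ; _~_   = λ x y → splitAt (order G) x ≈ splitAt (order G) y
  ; _~?_  = λ x y → dec (splitAt (order G) x) (splitAt (order G) y)
  ; ~-sym = λ {x} {y} → symm (splitAt (order G) x) (splitAt (order G) y)
  ; ~-irr = λ { {x} refl → irr (splitAt (order G) x) }
  }
  where
  module G = Graph G
  module D = Graph D

  across : G.Point → Fin ∣ ∁ q ∣ → Set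
  across x c = ∃[ i ] (nth p i ≡ x × nth q (_≅_.to φ i) D.~ nth (∁ q) c)

  across? : ∀ x c → Dec (across x c)
  across? x c = any? λ i → nth p i ≟ x ×-dec nth q (_≅_.to φ i) D.~? nth (∁ q) c

  _≈_ : Rel (G.Point ⊎ Fin ∣ ∁ q ∣) 0ℓ
  inj₁ x ≈ inj₁ y = x G.~ y
  inj₁ x ≈ inj₂ d = across x d
  inj₂ c ≈ inj₁ y = across y c
  inj₂ c ≈ inj₂ d = nth (∁ q) c D.~ nth (∁ q) d

  dec : Decidable _≈_
  dec (inj₁ x) (inj₁ y) = x G.~? y
  dec (inj₁ x) (inj₂ d) = across? x d
  dec (inj₂ c) (inj₁ y) = across? y c
  dec (inj₂ c) (inj₂ d) = nth (∁ q) c D.~? nth (∁ q) d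

  symm : ∀ a b → a ≈ b → b ≈ a
  symm (inj₁ x) (inj₁ y) = G.~-sym
  symm (inj₁ x) (inj₂ d) e = e
  symm (inj₂ c) (inj₁ y) e = e
  symm (inj₂ c) (inj₂ d) = D.~-sym

  irr : ∀ a → ¬ (a ≈ a)
  irr (inj₁ x) = G.~-irr refl
  irr (inj₂ c) = D.~-irr refl

-- Graphs are considered up to isomorphism, hence the last constructor.
data Contractible : Graph → Set₁ where
  K₁          : Contractible (edgeless 1)
  pointDelete : ∀ {G} v → Contractible G → Contractible (rim G v) →
                Contractible (G ∖ ⁅ v ⁆)
  pointAdd    : ∀ {G} p → Contractible G → Contractible (induced G p) →
                Contractible (addPoint G p)
  edgeDelete  : ∀ {G} v u → let open Graph G in v ~ u →
                Contractible G → Contractible (rim₂ G v u) →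
                Contractible (deleteEdge G v u)
  edgeAdd     : ∀ {G} v u → let open Graph G in v ≢ u → ¬ (v ~ u) →
                Contractible G → Contractible (rim₂ G v u) →
                Contractible (addEdge G v u)
  relabel     : ∀ {G H} → G ≅ H → Contractible G → Contractible H

IsSphere₀ : Graph → Set
IsSphere₀ G = G ≅ edgeless 2

IsSphere₁ : Graph → Set
IsSphere₁ G = Connected G × (∀ v → IsSphere₀ (rim G v))

IsDisk₁ : Graph → Set₁
IsDisk₁ G = ∃[ S ] (IsSphere₁ S × ∃[ v ] (G ≅ S ∖ ⁅ v ⁆))

-- D is a digital 2-disk with boundary ∂ and interior ∁ ∂.
record IsDisk₂ (D : Graph) (∂ : Subset (order D)) : Set₁ where
  field
    connected         : Connected D
    contractible      : Contractible D
    boundary-nonempty : Nonempty ∂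
    interior-nonempty : Nonempty (∁ ∂)
    boundary-rims     : ∀ v → v ∈ ∂ → IsDisk₁ (rim D v)
    interior-rims     : ∀ v → v ∈ ∁ ∂ → IsSphere₁ (rim D v)
    boundary-sphere   : IsSphere₁ (induced D ∂)

-- The subspace of K on d is a digital 2-disk whose boundary is the subspace on s.
record DiskIn (K : Graph) (d s : Subset (order K)) : Set₁ where
  field
    boundary⊆disk : s ⊆ d
    isDisk        : IsDisk₂ (induced K d) (restrict d s)

IsSphere₂ : Graph → Set₁
IsSphere₂ G =
  ∃[ D ] ∃[ ∂D ] ∃[ C ] ∃[ ∂C ]
    (IsDisk₂ D ∂D × IsDisk₂ C ∂C ×
     ∃[ φ ] (G ≅ glue D ∂D C ∂C φ))

IsManifold₂ : Graph → Set
IsManifold₂ G = Connected G × (∀ v → IsSphere₁ (rim G v))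

infix 4 _⟶_
data _⟶_ (N M : Graph) : Set₁ where
  shrink : IsManifold₂ N →
           ∀ {d s} → DiskIn N d s →
           ∀ v → v ∈ d ─ s →
           M ≅ join N v s ∖ ((d ─ s) - v) →
           N ⟶ M
  -- v ↑ˡ _ is v as a point of the glued graph.
  expand : IsManifold₂ N →
           ∀ v {D ∂} → IsDisk₂ D ∂ →
           (φ : rim N v ≅ induced D ∂) →
           M ≅ glue N (neighbours N v) D ∂ φ ∖ ⁅ v ↑ˡ _ ⁆ →
           N ⟶ M

Equivalent : Graph → Graph → Set₁
Equivalent H K = Star _⟶_ H K ⊎ Star _⟶_ K H

module Submission where

-- Delete the points of H one at a time, beginning with an arbitrary x, so that the rim of
-- each point at the moment of its deletion is an arc.  Then H ∖ ⁅ x ⁆ is contractible, and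
-- H is the union of two disks, H ∖ ⁅ x ⁆ and the star of x, with common boundary O(x).
-- To continue, let U be the set of remaining points, and suppose that U and its complement
-- are connected.  Some point y of U next to the complement is not a cut point of U.  Its rim
-- in U is connected: otherwise an induced path in U - y between two components of the rim
-- closes up through y to a 1-sphere, which by hypothesis bounds a disk.  The complement of U
-- is connected and avoids this sphere, so it lies on one side of it, although the rim of y
-- has points of the complement on both sides.  Hence the rim of y in U is an arc, and U - y
-- and its complement are connected again.

open import Defs
open import Data.Fin using (Fin; zero; suc; _≟_; _↑ˡ_; _↑ʳ_; splitAt)
open import Data.Fin.Properties using (suc-injective; any?; splitAt-↑ˡ; splitAt-↑ʳ; join-splitAt)
open import Data.Fin.Subset
  using (Subset; inside; outside; _∈_; _∉_; _⊆_; _⊂_; _∪_; _-_; ∁; ⁅_⁆; ∣_∣)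
open import Data.Fin.Subset.Induction using (Acc; acc; ⊂-wellFounded; ⊃-wellFounded)
open import Data.Fin.Subset.Properties
  using (_∈?_; ∈⊤; x∈p∧x≢y⇒x∈p-y; p─q⊆p; x∈p⇒p-x⊂p; x∈⁅x⁆; x∈⁅y⁆⇒x≡y; x≢y⇒x∉⁅y⁆; x∈∁p⇒x∉p;
         x∉p⇒x∈∁p; x∈p∪q⁻; p⊆p∪q; q⊆p∪q)
open import Data.Nat using (ℕ; suc)
open import Data.Product using (_×_; _,_; ∃; ∃-syntax; proj₁; proj₂)
open import Data.Sum using (_⊎_; inj₁; inj₂; swap)
open import Data.Unit using (⊤; tt)
open import Data.Vec using ([]; _∷_; here; there; tabulate)
open import Data.Vec.Properties using (lookup⇒[]=; []=⇒lookup; lookup∘tabulate)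
open import Function using (id; _∘_; Inverse; Equivalence; mk↔ₛ′; mk⇔)
open import Relation.Binary.Construct.Closure.ReflexiveTransitive
  using (Star; ε; _◅_; _◅◅_; gmap; map; reverse)
open import Relation.Binary.PropositionalEquality
  using (_≡_; _≢_; refl; sym; trans; cong; subst; subst₂; ≢-sym)
open import Relation.Nullary using (¬_; Dec; yes; no; does; contradiction)
open import Relation.Nullary.Decidable using (_×-dec_; _⊎-dec_; ¬?; dec-true)
import Data.Fin as Fin
import Data.Fin.Subset as Subset

open Graph using (order; Point; neighbours; Connected)

-- The disks of the hypothesis stand in for the Jordan curve theorem. A point off the boundary of a
-- disk in `H` has as its rim in the disk a 1-sphere, which lies in the 1-sphere that is its rim in
-- `H`; the two coincide, so the point has no neighbour outside the disk. Hence a connected set that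
-- avoids the boundary is wholly inside or wholly outside, although nothing is known about the shape
-- of the outside. Two demands on `y` compete: a point that is not a cut point of `U` is easy to
-- find somewhere, but the rim of `y` in `U` is a proper part of a cycle only if `y` touches the
-- complement. This forces a descent through cut points that all lie next to the complement. A path
-- between two points of the rim may meet the rim on its way, and then it does not close up to a
-- 1-sphere. So an arbitrary induced path is cut where it meets the rim, and each portion between
-- consecutive meetings is replaced by a walk inside the rim.

module _ {n : ℕ} {P : Fin n → Set} (P? : ∀ x → Dec (P x)) where

  -- This has the same form as `neighbours`, so its membership lemmas apply to rims as they stand.
  comprehension : Subset n
  comprehension = tabulate (λ x → does (P? x))

  ∈-comprehension⁺ : ∀ {x} → P x → x ∈ comprehension
  ∈-comprehension⁺ {x} px =
    lookup⇒[]= x _ (trans (lookup∘tabulate _ x) (dec-true (P? x) px))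

  ∈-comprehension⁻ : ∀ {x} → x ∈ comprehension → P x
  ∈-comprehension⁻ {x} x∈
    with P? x | trans (sym (lookup∘tabulate (λ y → does (P? y)) x)) ([]=⇒lookup x∈)
  ... | yes px | _ = px

x∉p-x : ∀ {n} {p : Subset n} {x} → x ∉ p - x
x∉p-x {p = _ ∷ _} {suc x} (there x∈) = x∉p-x x∈
x∉p-x {p = inside ∷ _} {zero} ()
x∉p-x {p = outside ∷ _} {zero} ()

x∈p-y⇒x∈p : ∀ {n} {p : Subset n} {x y} → x ∈ p - y → x ∈ p
x∈p-y⇒x∈p {p = p} {y = y} = p─q⊆p p ⁅ y ⁆

x∈p-y⇒x≢y : ∀ {n} {p : Subset n} {x y} → x ∈ p - y → x ≢ y
x∈p-y⇒x≢y {p = p} x∈ refl = x∉p-x {p = p} x∈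

-- Enumeration of the points of a subset

nth-∈ : ∀ {n} (p : Subset n) i → nth p i ∈ p
nth-∈ (inside  ∷ p) zero    = here
nth-∈ (inside  ∷ p) (suc i) = there (nth-∈ p i)
nth-∈ (outside ∷ p) i       = there (nth-∈ p i)

nth-injective : ∀ {n} (p : Subset n) {i j} → nth p i ≡ nth p j → i ≡ j
nth-injective (inside  ∷ p) {zero}  {zero}  _  = refl
nth-injective (inside  ∷ p) {suc i} {suc j} eq = cong suc (nth-injective p (suc-injective eq))
nth-injective (outside ∷ p) eq = nth-injective p (suc-injective eq)

nth-surjective : ∀ {n} (p : Subset n) {x} → x ∈ p → ∃[ i ] nth p i ≡ x
nth-surjective (inside ∷ p) here = zero , refl
nth-surjective (inside ∷ p) (there x∈) with i , refl ← nth-surjective p x∈ = suc i , refl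
nth-surjective (outside ∷ p) (there x∈) with i , refl ← nth-surjective p x∈ = i , refl

∈-restrict⁺ : ∀ {n} (p q : Subset n) {i} → nth p i ∈ q → i ∈ restrict p q
∈-restrict⁺ p q {i} x∈ =
  lookup⇒[]= i _ (trans (lookup∘tabulate _ i) ([]=⇒lookup x∈))

∈-restrict⁻ : ∀ {n} (p q : Subset n) {i} → i ∈ restrict p q → nth p i ∈ q
∈-restrict⁻ p q {i} i∈ =
  lookup⇒[]= _ q (trans (sym (lookup∘tabulate _ i)) ([]=⇒lookup i∈))

-- Embeddings onto subspaces and the isomorphisms they yield

≅-edge⁺ : ∀ {G H} (φ : G ≅ H) {x y} → Graph._~_ G x y → Graph._~_ H (_≅_.to φ x) (_≅_.to φ y)
≅-edge⁺ φ {x} {y} = Equivalence.to (_≅_.edges φ x y)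

≅-edge⁻ : ∀ {G H} (φ : G ≅ H) {x y} → Graph._~_ H (_≅_.to φ x) (_≅_.to φ y) → Graph._~_ G x y
≅-edge⁻ φ {x} {y} = Equivalence.from (_≅_.edges φ x y)

-- An isomorphism of G onto the subspace of H on the points satisfying P.  Two
-- graphs embedded with the same image are isomorphic, which identifies iterated
-- induced subgraphs without comparing their numberings.
record Embedding (G H : Graph) (P : Point H → Set) : Set where
  private
    module G = Graph G
    module H = Graph H
  field
    map⟨_⟩    : G.Point → H.Point
    injective : ∀ {x y} → map⟨_⟩ x ≡ map⟨_⟩ y → x ≡ y
    edge⁺     : ∀ {x y} → x G.~ y → map⟨_⟩ x H.~ map⟨_⟩ y
    edge⁻     : ∀ {x y} → map⟨_⟩ x H.~ map⟨_⟩ y → x G.~ y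
    image     : ∀ x → P (map⟨_⟩ x)
    covers    : ∀ {h} → P h → ∃[ x ] map⟨_⟩ x ≡ h

open Embedding

≅⇒embedding : ∀ {G H} → G ≅ H → Embedding G H (λ _ → ⊤)
≅⇒embedding φ = record
  { map⟨_⟩    = to
  ; injective = λ {x} {y} eq → trans (sym (inverseʳ refl)) (trans (cong from eq) (inverseʳ refl))
  ; edge⁺     = ≅-edge⁺ φ
  ; edge⁻     = ≅-edge⁻ φ
  ; image     = λ _ → tt
  ; covers    = λ {h} _ → from h , inverseˡ refl
  }
  where
  open _≅_ φ using (to; from; points)
  open Inverse points using (inverseˡ; inverseʳ)

embedding-id : ∀ {G} → Embedding G G (λ _ → ⊤)
embedding-id = record
  { map⟨_⟩ = id ; injective = id ; edge⁺ = id ; edge⁻ = id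
  ; image = λ _ → tt ; covers = λ {h} _ → h , refl }

induced-embedding : ∀ G p → Embedding (induced G p) G (_∈ p)
induced-embedding G p = record
  { map⟨_⟩    = nth p
  ; injective = nth-injective p
  ; edge⁺     = id
  ; edge⁻     = id
  ; image     = nth-∈ p
  ; covers    = nth-surjective p
  }

embedding-∘ : ∀ {A B C P Q} → Embedding A B P → (g : Embedding B C Q) →
              Embedding A C (λ c → ∃[ b ] (P b × map⟨ g ⟩ b ≡ c))
embedding-∘ f g = record
  { map⟨_⟩    = λ a → map⟨ g ⟩ (map⟨ f ⟩ a)
  ; injective = λ eq → injective f (injective g eq)
  ; edge⁺     = λ e → edge⁺ g (edge⁺ f e)
  ; edge⁻     = λ e → edge⁻ f (edge⁻ g e)
  ; image     = λ a → map⟨ f ⟩ a , image f a , refl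
  ; covers    = λ { (b , pb , refl) → let a , eq = covers f pb in a , cong (map⟨ g ⟩) eq }
  }

embedding-resp : ∀ {G H P Q} → (∀ {h} → P h → Q h) → (∀ {h} → Q h → P h) →
                 Embedding G H P → Embedding G H Q
embedding-resp P⊆Q Q⊆P f = record
  { map⟨_⟩ = map⟨ f ⟩ ; injective = injective f ; edge⁺ = edge⁺ f ; edge⁻ = edge⁻ f
  ; image = λ x → P⊆Q (image f x) ; covers = λ q → covers f (Q⊆P q) }

module _ {A B H : Graph} {P : Point H → Set} (f : Embedding A H P) (g : Embedding B H P) where

  private
    to : Point A → Point B
    to a = proj₁ (covers g (image f a))

    from : Point B → Point A
    from b = proj₁ (covers f (image g b))

    from-commutes : ∀ b → map⟨ f ⟩ (from b) ≡ map⟨ g ⟩ b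
    from-commutes b = proj₂ (covers f (image g b))

  -- Needed for gluing: two points identified by an isomorphism of this kind are one and the same
  -- point of `H`.
  embedding-unique-commutes : ∀ a → map⟨ g ⟩ (to a) ≡ map⟨ f ⟩ a
  embedding-unique-commutes a = proj₂ (covers g (image f a))

  embedding-unique : A ≅ B
  embedding-unique = record
    { points = mk↔ₛ′ to from
        (λ b → injective g (trans (embedding-unique-commutes (from b)) (from-commutes b)))
        (λ a → injective f (trans (from-commutes (to a)) (embedding-unique-commutes a)))
    ; edges  = λ x y → mk⇔
        (λ e → edge⁻ g (subst₂ (Graph._~_ H) (sym (embedding-unique-commutes x))
                                              (sym (embedding-unique-commutes y)) (edge⁺ f e)))
        (λ e → edge⁻ f (subst₂ (Graph._~_ H) (embedding-unique-commutes x)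
                                              (embedding-unique-commutes y) (edge⁺ g e)))
    }

≅-sym : ∀ {G H} → G ≅ H → H ≅ G
≅-sym φ = embedding-unique embedding-id (≅⇒embedding φ)

embedding-≅ : ∀ {G G′ H P} → G ≅ G′ → Embedding G′ H P → Embedding G H P
embedding-≅ φ f =
  embedding-resp (λ { (b , _ , refl) → image f b }) (λ ph → let b , eq = covers f ph in b , tt , eq)
                 (embedding-∘ (≅⇒embedding φ) f)

subspace-embedding : ∀ {G H P Q} (f : Embedding G H P) q →
                     (∀ {x} → x ∈ q → Q (map⟨ f ⟩ x)) →
                     (∀ {h} → Q h → P h) →
                     (∀ {x} → Q (map⟨ f ⟩ x) → x ∈ q) →
                     Embedding (induced G q) H Q
subspace-embedding {G} {Q = Q} f q q⊆Q Q⊆P Q⊆q =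
  embedding-resp (λ { (b , b∈ , refl) → q⊆Q b∈ })
                 (λ qh → let b , eq = covers f (Q⊆P qh) in b , Q⊆q (subst Q (sym eq) qh) , eq)
                 (embedding-∘ (induced-embedding G q) f)

∈-neighbours⁺ : ∀ G {v u} → Graph._~_ G v u → u ∈ neighbours G v
∈-neighbours⁺ G {v} = ∈-comprehension⁺ (Graph._~?_ G v)

∈-neighbours⁻ : ∀ G {v u} → u ∈ neighbours G v → Graph._~_ G v u
∈-neighbours⁻ G {v} = ∈-comprehension⁻ (Graph._~?_ G v)

rim-embedding : ∀ {G H P} (f : Embedding G H P) v →
                Embedding (rim G v) H (λ h → P h × Graph._~_ H (map⟨ f ⟩ v) h)
rim-embedding {G} f v =
  subspace-embedding f (neighbours G v)
    (λ {x} x∈ → image f x , edge⁺ f (∈-neighbours⁻ G x∈)) proj₁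
    (λ { (_ , e) → ∈-neighbours⁺ G (edge⁻ f e) })

-- Walks and connected components

module Walks (H : Graph) where

  open Graph H using (_~_; _~?_; ~-sym; ~-irr)

  Step : (Point H → Set) → Point H → Point H → Set
  Step P x y = P x × x ~ y × P y

  Walk : (Point H → Set) → Point H → Point H → Set
  Walk P = Star (Step P)

  -- Unlike connectedness, this allows P to be empty.
  Linked : (Point H → Set) → Set
  Linked P = ∀ {x y} → P x → P y → Walk P x y

  module _ {P Q : Point H → Set} where

    walk-map : (∀ {x} → P x → Q x) → ∀ {x y} → Walk P x y → Walk Q x y
    walk-map P⊆Q = map λ { (px , e , py) → P⊆Q px , e , P⊆Q py }

    linked-resp : (∀ {x} → P x → Q x) → (∀ {x} → Q x → P x) → Linked P → Linked Q
    linked-resp P⊆Q Q⊆P l qx qy = walk-map P⊆Q (l (Q⊆P qx) (Q⊆P qy))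

  module _ {P : Point H → Set} where

    walk-reverse : ∀ {x y} → Walk P x y → Walk P y x
    walk-reverse = reverse λ { (px , e , py) → py , ~-sym e , px }

    walk-target : ∀ {x y} → P x → Walk P x y → P y
    walk-target px ε                  = px
    walk-target px ((_ , _ , py) ◅ w) = walk-target py w

    linked-via : ∀ c → (∀ {x} → P x → Walk P c x) → Linked P
    linked-via c w px py = walk-reverse (w px) ◅◅ w py

    exit : ∀ {x y} (p : Subset (order H)) → Walk P x y → x ∈ p → y ∉ p →
           ∃[ a ] ∃[ b ] (a ∈ p × b ∉ p × a ~ b × P a × P b)
    exit p ε x∈ y∉ = contradiction x∈ y∉
    exit p (_◅_ {j = z} (px , e , pz) w) x∈ y∉ with z ∈? p
    ... | yes z∈ = exit p w z∈ y∉
    ... | no  z∉ = _ , z , x∈ , z∉ , e , px , pz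

    -- A walk is rerouted around y along the rim of y.
    linked-delete : ∀ y → Linked P → Linked (λ z → P z × y ~ z) → Linked (λ z → P z × z ≢ y)
    linked-delete y l lʸ (pa , a≢y) (pb , b≢y) = away (l pa pb) a≢y b≢y
      where
      P′ : Point H → Set
      P′ z = P z × z ≢ y

      onRim : ∀ {z} → P z × y ~ z → P′ z
      onRim (pz , e) = pz , λ { refl → ~-irr refl e }

      away : ∀ {a b} → Walk P a b → a ≢ y → b ≢ y → Walk P′ a b
      at   : ∀ {a b} → P a × y ~ a → Walk P y b → b ≢ y → Walk P′ a b

      away ε _ _ = ε
      away (_◅_ {j = c} (pa , e , pc) w) a≢y b≢y with c ≟ y
      ... | yes refl = at (pa , ~-sym e) w b≢y
      ... | no  c≢y  = ((pa , a≢y) , e , pc , c≢y) ◅ away w c≢y b≢y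

      at _ ε b≢y = contradiction refl b≢y
      at ra ((_ , e , pc) ◅ w) b≢y =
        walk-map onRim (lʸ ra (pc , e)) ◅◅ away w (λ { refl → ~-irr refl e }) b≢y

  -- The walks stay in the component itself, so they can be carried over to any region that contains
  -- it.
  record Component (U : Subset (order H)) (v : Point H) : Set where
    field
      points : Subset (order H)
      base   : v ∈ points
      within : points ⊆ U
      walks  : ∀ {c} → c ∈ points → Walk (_∈ points) v c
      closed : ∀ {c u} → c ∈ points → u ∈ U → c ~ u → u ∈ points

  component : ∀ U {v} → v ∈ U → Component U v
  component U {v} v∈U =
    grow ⁅ v ⁆ (⊃-wellFounded _) (x∈⁅x⁆ v) (λ x∈ → subst (_∈ U) (sym (x∈⁅y⁆⇒x≡y v x∈)) v∈U)
         (λ x∈ → subst (Walk _ v) (sym (x∈⁅y⁆⇒x≡y v x∈)) ε)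
    where
    grow : ∀ C → Acc (λ p q → q ⊂ p) C → v ∈ C → C ⊆ U →
           (∀ {c} → c ∈ C → Walk (_∈ C) v c) → Component U v
    grow C (acc rs) v∈C C⊆U walks
      with any? (λ u → u ∈? U ×-dec ¬? (u ∈? C) ×-dec any? (λ c → c ∈? C ×-dec c ~? u))
    ... | no none =
      record { points = C ; base = v∈C ; within = C⊆U ; walks = walks ; closed = closed }
      where
      closed : ∀ {c u} → c ∈ C → u ∈ U → c ~ u → u ∈ C
      closed {c} {u} c∈ u∈ e with u ∈? C
      ... | yes u∈C = u∈C
      ... | no  u∉C = contradiction (u , u∈ , u∉C , c , c∈ , e) none
    ... | yes (u , u∈U , u∉C , c , c∈C , e) =
      grow C′ (rs (C⊆C′ , u , u∈C′ , u∉C)) (C⊆C′ v∈C) C′⊆U walks′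
      where
      C′? = λ x → x ∈? C ⊎-dec x ≟ u
      C′ = comprehension C′?
      C⊆C′ : C ⊆ C′
      C⊆C′ = ∈-comprehension⁺ C′? ∘ inj₁
      u∈C′ : u ∈ C′
      u∈C′ = ∈-comprehension⁺ C′? (inj₂ refl)
      C′⊆U : C′ ⊆ U
      C′⊆U x∈ with ∈-comprehension⁻ C′? x∈
      ... | inj₁ x∈C  = C⊆U x∈C
      ... | inj₂ refl = u∈U
      walks′ : ∀ {x} → x ∈ C′ → Walk (_∈ C′) v x
      walks′ x∈ with ∈-comprehension⁻ C′? x∈
      ... | inj₁ x∈C  = walk-map C⊆C′ (walks x∈C)
      ... | inj₂ refl = walk-map C⊆C′ (walks c∈C) ◅◅ (C⊆C′ c∈C , e , u∈C′) ◅ ε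

-- Digital 0-spheres and 1-spheres inside an ambient graph

module Cycles (H : Graph) where

  open Graph H using (_~_; ~-sym; ~-irr)
  open Walks H public

  record NonadjacentPair (P : Point H → Set) : Set where
    field
      left right  : Point H
      distinct    : left ≢ right
      nonadjacent : ¬ (left ~ right)
      left-∈      : P left
      right-∈     : P right
      only        : ∀ {z} → P z → z ≡ left ⊎ z ≡ right

  open NonadjacentPair

  -- The ambient form of a digital 1-sphere, which spares renumbering when rims in different
  -- subspaces are compared. The two neighbours of a point are nonadjacent, so a triangle does not
  -- qualify.
  record Cycle (P : Point H → Set) : Set where
    field
      nonempty : ∃ P
      linked   : Linked P
      pairs    : ∀ {u} → P u → NonadjacentPair (λ z → P z × u ~ z)

  open Cycle

  pair-swap : ∀ {P} → NonadjacentPair P → NonadjacentPair P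
  pair-swap π = record
    { left = right π ; right = left π ; distinct = ≢-sym (distinct π)
    ; nonadjacent = λ e → nonadjacent π (~-sym e)
    ; left-∈ = right-∈ π ; right-∈ = left-∈ π ; only = λ p → swap (only π p) }

  pair-resp : ∀ {P Q} → (∀ {z} → P z → Q z) → (∀ {z} → Q z → P z) →
              NonadjacentPair P → NonadjacentPair Q
  pair-resp P⊆Q Q⊆P π = record
    { left = left π ; right = right π ; distinct = distinct π ; nonadjacent = nonadjacent π
    ; left-∈ = P⊆Q (left-∈ π) ; right-∈ = P⊆Q (right-∈ π) ; only = λ q → only π (Q⊆P q) }

  cycle-resp : ∀ {P Q} → (∀ {z} → P z → Q z) → (∀ {z} → Q z → P z) → Cycle P → Cycle Q
  cycle-resp P⊆Q Q⊆P γ = record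
    { nonempty = let z , pz = nonempty γ in z , P⊆Q pz
    ; linked   = linked-resp P⊆Q Q⊆P (linked γ)
    ; pairs    = λ qu → pair-resp (λ { (pz , e) → P⊆Q pz , e }) (λ { (qz , e) → Q⊆P qz , e })
                                  (pairs γ (Q⊆P qu)) }

  pair-⊇ : ∀ {P Q} → NonadjacentPair P → NonadjacentPair Q → (∀ {z} → P z → Q z) → ∀ {z} → Q z → P z
  pair-⊇ {P} π ρ P⊆Q {z} qz with only ρ qz | only ρ (P⊆Q (left-∈ π)) | only ρ (P⊆Q (right-∈ π))
  ... | inj₁ refl | inj₁ eq | _       = subst P eq (left-∈ π)
  ... | inj₁ refl | inj₂ _  | inj₁ eq = subst P eq (right-∈ π)
  ... | inj₁ refl | inj₂ eq | inj₂ eq′ = contradiction (trans eq (sym eq′)) (distinct π)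
  ... | inj₂ refl | inj₂ eq | _       = subst P eq (left-∈ π)
  ... | inj₂ refl | inj₁ _  | inj₂ eq = subst P eq (right-∈ π)
  ... | inj₂ refl | inj₁ eq | inj₁ eq′ = contradiction (trans eq (sym eq′)) (distinct π)

  -- Each point of the smaller cycle already has both of its neighbours in the larger one, so a walk
  -- in the larger cycle cannot leave the smaller.
  cycle-⊇ : ∀ {P Q} → Cycle P → Cycle Q → (∀ {z} → P z → Q z) → ∀ {z} → Q z → P z
  cycle-⊇ {P} {Q} γ δ P⊆Q qz = go (proj₂ (nonempty γ)) (linked δ (P⊆Q (proj₂ (nonempty γ))) qz)
    where
    go : ∀ {x y} → P x → Walk Q x y → P y
    go px ε = px
    go px ((qx , e , qz) ◅ w) =
      go (proj₁ (pair-⊇ (pairs γ px) (pairs δ qx) (λ { (p , e) → P⊆Q p , e }) (qz , e))) w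

  sphere₀⇒pair : ∀ {A P} → Embedding A H P → IsSphere₀ A → NonadjacentPair P
  sphere₀⇒pair f φ = record
    { left = map⟨ g ⟩ zero ; right = map⟨ g ⟩ (suc zero)
    ; distinct = λ eq → contradiction (injective g eq) λ ()
    ; nonadjacent = edge⁻ g
    ; left-∈ = image g _ ; right-∈ = image g _
    ; only = λ p → only′ (covers g p) }
    where
    g = embedding-≅ (≅-sym φ) f
    only′ : ∀ {z} → ∃[ i ] map⟨ g ⟩ i ≡ z → z ≡ map⟨ g ⟩ zero ⊎ z ≡ map⟨ g ⟩ (suc zero)
    only′ (zero , eq)     = inj₁ (sym eq)
    only′ (suc zero , eq) = inj₂ (sym eq)

  pair⇒sphere₀ : ∀ {A P} → Embedding A H P → NonadjacentPair P → IsSphere₀ A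
  pair⇒sphere₀ {P = P} f π = embedding-unique f g
    where
    pick : Fin 2 → Point H
    pick zero       = left π
    pick (suc zero) = right π

    pick-injective : ∀ {i j} → pick i ≡ pick j → i ≡ j
    pick-injective {zero}     {zero}     _  = refl
    pick-injective {zero}     {suc zero} eq = contradiction eq (distinct π)
    pick-injective {suc zero} {zero}     eq = contradiction (sym eq) (distinct π)
    pick-injective {suc zero} {suc zero} _  = refl

    pick-edge : ∀ {i j} → ¬ (pick i ~ pick j)
    pick-edge {zero}     {zero}     = ~-irr refl
    pick-edge {zero}     {suc zero} = nonadjacent π
    pick-edge {suc zero} {zero}     = λ e → nonadjacent π (~-sym e)
    pick-edge {suc zero} {suc zero} = ~-irr refl

    g : Embedding (edgeless 2) H P
    g = record
      { map⟨_⟩    = pick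
      ; injective = pick-injective
      ; edge⁺     = λ ()
      ; edge⁻     = λ {i} {j} → pick-edge {i} {j}
      ; image     = λ { zero → left-∈ π ; (suc zero) → right-∈ π }
      ; covers    = λ {z} p → covers′ (only π p)
      }
      where
      covers′ : ∀ {z} → z ≡ left π ⊎ z ≡ right π → ∃[ i ] pick i ≡ z
      covers′ (inj₁ eq) = zero , sym eq
      covers′ (inj₂ eq) = suc zero , sym eq

  module _ {A : Graph} {P : Point H → Set} (f : Embedding A H P) where

    connected⇒linked : Connected A → Linked P
    connected⇒linked (_ , w) px py with covers f px | covers f py
    ... | a , refl | b , refl =
      gmap (map⟨ f ⟩) (λ {x} {y} e → image f x , edge⁺ f e , image f y) (w a b)

    linked⇒connected : ∃ P → Linked P → Connected A
    linked⇒connected (_ , p) l =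
      proj₁ (covers f p) , λ a b → pull (l (image f a) (image f b)) refl refl
      where
      pull : ∀ {x y a b} → Walk P x y → map⟨ f ⟩ a ≡ x → map⟨ f ⟩ b ≡ y → Star (Graph._~_ A) a b
      pull {a = a} ε eq eq′ = subst (Star _ a) (injective f (trans eq (sym eq′))) ε
      pull ((_ , e , pz) ◅ w) refl eq′ with covers f pz
      ... | c , refl = edge⁻ f e ◅ pull w refl eq′

    sphere₁⇒cycle : IsSphere₁ A → Cycle P
    sphere₁⇒cycle (c , rims) = record
      { nonempty = map⟨ f ⟩ (proj₁ c) , image f (proj₁ c)
      ; linked   = connected⇒linked c
      ; pairs    = λ pu → pairs′ (covers f pu)
      }
      where
      pairs′ : ∀ {u} → ∃[ a ] map⟨ f ⟩ a ≡ u → NonadjacentPair (λ z → P z × u ~ z)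
      pairs′ (a , refl) = sphere₀⇒pair (rim-embedding f a) (rims a)

    cycle⇒sphere₁ : Cycle P → IsSphere₁ A
    cycle⇒sphere₁ γ =
      linked⇒connected (nonempty γ) (linked γ) ,
      λ a → pair⇒sphere₀ (rim-embedding f a) (pairs γ (image f a))

  -- The handshake lemma in the only case needed: one point of odd degree is impossible.
  no-lone-end : ∀ C → Acc _⊂_ C → ∀ {a a′} → a ∈ C → a′ ∈ C → a ~ a′ →
                (∀ {z} → z ∈ C → a ~ z → z ≡ a′) →
                (∀ {u} → u ∈ C → u ≢ a → NonadjacentPair (λ z → z ∈ C × u ~ z)) →
                ∀ {X : Set} → X
  no-lone-end C (acc rs) {a} {a′} a∈ a′∈ e only-a′ two = next (two a′∈ a′≢a)
    where
    a′≢a : a′ ≢ a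
    a′≢a refl = ~-irr refl e

    C′ = C - a

    a′∈C′ : a′ ∈ C′
    a′∈C′ = x∈p∧x≢y⇒x∈p-y a′∈ a′≢a

    -- Deleting the lone end `a` takes a neighbour from `a′` only, so `a′` is the lone end of the
    -- smaller set.
    two′ : ∀ {u} → u ∈ C′ → u ≢ a′ → NonadjacentPair (λ z → z ∈ C′ × u ~ z)
    two′ u∈C′ u≢a′ =
      pair-resp (λ { (z∈ , e) → x∈p∧x≢y⇒x∈p-y z∈ (λ { refl → u≢a′ (only-a′ u∈ (~-sym e)) }) , e })
                (λ { (z∈ , e) → x∈p-y⇒x∈p z∈ , e })
                (two u∈ (x∈p-y⇒x≢y {p = C} u∈C′))
      where u∈ = x∈p-y⇒x∈p u∈C′

    shorter : ∀ (π : NonadjacentPair (λ z → z ∈ C × a′ ~ z)) → left π ≡ a → ∀ {X : Set} → X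
    shorter π refl =
      no-lone-end C′ (rs (x∈p⇒p-x⊂p a∈)) a′∈C′
        (x∈p∧x≢y⇒x∈p-y (proj₁ (right-∈ π)) (≢-sym (distinct π)))
        (proj₂ (right-∈ π)) only-right two′
      where
      only-right : ∀ {z} → z ∈ C′ → a′ ~ z → z ≡ right π
      only-right z∈ e with only π (x∈p-y⇒x∈p z∈ , e)
      ... | inj₁ z≡a = contradiction z≡a (x∈p-y⇒x≢y {p = C} z∈)
      ... | inj₂ eq  = eq

    next : NonadjacentPair (λ z → z ∈ C × a′ ~ z) → ∀ {X : Set} → X
    next π with only π (a∈ , ~-sym e)
    ... | inj₁ eq = shorter π (sym eq)
    ... | inj₂ eq = shorter (pair-swap π) (sym eq)

  -- Let `C` be the component of `x` in `A - v`, and suppose that it misses `y`. If both neighbours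
  -- of `v` are in `C`, then `C` together with `v` is closed under adjacency in `A`; if neither is,
  -- then `C` is closed. Both contradict the connectedness of the cycle. If exactly one is, it has
  -- one neighbour in `C` while all other points of `C` have two, against `no-lone-end`.
  cycle-delete : ∀ A → Cycle (_∈ A) → ∀ {v} → v ∈ A → Linked (λ z → z ∈ A × z ≢ v)
  cycle-delete A γ {v} v∈A {x} {y} (x∈A , x≢v) (y∈A , y≢v) = decide (y ∈? C)
    where
    A′ = A - v
    open Component (component A′ (x∈p∧x≢y⇒x∈p-y x∈A x≢v)) renaming (points to C)

    closed′ : ∀ {c u} → c ∈ C → u ∈ A → u ≢ v → c ~ u → u ∈ C
    closed′ c∈ u∈ u≢v = closed c∈ (x∈p∧x≢y⇒x∈p-y u∈ u≢v)

    C⊆A : ∀ {z} → z ∈ C → z ∈ A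
    C⊆A z∈ = x∈p-y⇒x∈p (within z∈)

    C≢v : ∀ {z} → z ∈ C → z ≢ v
    C≢v z∈ = x∈p-y⇒x≢y {p = A} (within z∈)

    one-end : ∀ (π : NonadjacentPair (λ z → z ∈ A × v ~ z)) → left π ∈ C → right π ∉ C →
              ∀ {X : Set} → X
    one-end π a∈C b∉C = split (pairs γ (C⊆A a∈C))
      where
      a = left π
      v~a = proj₂ (left-∈ π)

      two : ∀ {u} → u ∈ C → u ≢ a → NonadjacentPair (λ z → z ∈ C × u ~ z)
      two {u} u∈ u≢a =
        pair-resp (λ { (z∈ , e) → closed′ u∈ z∈ (λ { refl → u≁v (~-sym e) }) e , e })
                  (λ { (z∈ , e) → C⊆A z∈ , e }) (pairs γ (C⊆A u∈))
        where
        u≁v : ¬ (v ~ u)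
        u≁v e with only π (C⊆A u∈ , e)
        ... | inj₁ eq   = u≢a eq
        ... | inj₂ refl = b∉C u∈

      from-v : ∀ (ρ : NonadjacentPair (λ z → z ∈ A × a ~ z)) → left ρ ≡ v → ∀ {X : Set} → X
      from-v ρ refl =
        no-lone-end C (⊂-wellFounded C) a∈C
          (closed′ a∈C (proj₁ (right-∈ ρ)) (≢-sym (distinct ρ)) (proj₂ (right-∈ ρ)))
          (proj₂ (right-∈ ρ)) only-right two
        where
        only-right : ∀ {z} → z ∈ C → a ~ z → z ≡ right ρ
        only-right z∈ e with only ρ (C⊆A z∈ , e)
        ... | inj₁ z≡v = contradiction z≡v (C≢v z∈)
        ... | inj₂ eq  = eq

      split : NonadjacentPair (λ z → z ∈ A × a ~ z) → ∀ {X : Set} → X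
      split ρ with only ρ (v∈A , ~-sym v~a)
      ... | inj₁ eq = from-v ρ (sym eq)
      ... | inj₂ eq = from-v (pair-swap ρ) (sym eq)

    decide : Dec (y ∈ C) → Walk (λ z → z ∈ A × z ≢ v) x y
    decide (yes y∈C) = walk-map (λ z∈ → C⊆A z∈ , C≢v z∈) (walks y∈C)
    decide (no y∉C) = ends (left π ∈? C) (right π ∈? C)
      where
      π = pairs γ v∈A

      Cv? : ∀ z → Dec (z ∈ C ⊎ z ≡ v)
      Cv? z = z ∈? C ⊎-dec z ≟ v

      not-y : ¬ (y ∈ C ⊎ y ≡ v)
      not-y (inj₁ y∈) = y∉C y∈
      not-y (inj₂ eq) = y≢v eq

      ends : Dec (left π ∈ C) → Dec (right π ∈ C) → Walk (λ z → z ∈ A × z ≢ v) x y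
      ends (yes l∈) (no r∉)  = one-end π l∈ r∉
      ends (no l∉)  (yes r∈) = one-end (pair-swap π) r∈ l∉
      ends (no l∉)  (no r∉)
        with a , b , a∈ , b∉ , e , _ , b∈A ← exit C (linked γ x∈A v∈A) base (λ v∈ → C≢v v∈ refl)
        with b ≟ v
      ... | no b≢v = contradiction (closed′ a∈ b∈A b≢v e) b∉
      ... | yes refl with only π (C⊆A a∈ , ~-sym e)
      ...   | inj₁ refl = contradiction a∈ l∉
      ...   | inj₂ refl = contradiction a∈ r∉
      ends (yes l∈) (yes r∈)
        with a , b , a∈ , b∉ , e , a∈A , b∈A ←
          exit (comprehension Cv?) (linked γ x∈A y∈A) (∈-comprehension⁺ Cv? (inj₁ base))
               (λ y∈ → not-y (∈-comprehension⁻ Cv? y∈))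
        = b∉Cv (inj₁ (enter (∈-comprehension⁻ Cv? a∈) e b∈A (b∉Cv ∘ inj₂)))
        where
        b∉Cv : ∀ {X : Set} → b ∈ C ⊎ b ≡ v → X
        b∉Cv b∈ = contradiction (∈-comprehension⁺ Cv? b∈) b∉

        enter : ∀ {a b} → a ∈ C ⊎ a ≡ v → a ~ b → b ∈ A → b ≢ v → b ∈ C
        enter (inj₁ a∈C) e b∈A b≢v = closed′ a∈C b∈A b≢v e
        enter (inj₂ refl) e b∈A _ with only π (b∈A , e)
        ... | inj₁ refl = l∈
        ... | inj₂ refl = r∈

-- Digital 1-disks: connected, but not 1-spheres

module _ {S : Graph} (σ : IsSphere₁ S) (v : Point S) where

  open Graph S using (~-sym)
  open Cycles S
  open Cycle (sphere₁⇒cycle embedding-id σ)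
  open NonadjacentPair

  punctured-embedding : ∀ {G} → G ≅ S ∖ ⁅ v ⁆ → Embedding G S (_≢ v)
  punctured-embedding φ =
    embedding-≅ φ (embedding-resp (λ z∈ → λ { refl → x∈∁p⇒x∉p z∈ (x∈⁅x⁆ v) })
                                  (λ z≢v → x∉p⇒x∈∁p (x≢y⇒x∉⁅y⁆ z≢v))
                                  (induced-embedding S (∁ ⁅ v ⁆)))

  private
    π = pairs {v} tt
    a = left π

    a≢v : a ≢ v
    a≢v eq = Graph.~-irr S (sym eq) (proj₂ (left-∈ π))

  punctured-connected : Connected (S ∖ ⁅ v ⁆)
  punctured-connected =
    linked⇒connected (punctured-embedding (embedding-unique embedding-id embedding-id)) (a , a≢v)
      (linked-resp proj₂ (λ z≢v → ∈⊤ , z≢v)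
        (cycle-delete Subset.⊤ (cycle-resp (λ _ → ∈⊤) (λ _ → tt) (sphere₁⇒cycle embedding-id σ)) ∈⊤))

  -- A neighbour `a` of `v` has lost one of its two neighbours. In a 1-sphere it would still have
  -- two, which would exhaust its pair in `S` and so include `v`. This fact tells the boundary
  -- points of a disk from the interior ones.
  punctured-not-sphere₁ : ¬ IsSphere₁ (S ∖ ⁅ v ⁆)
  punctured-not-sphere₁ τ =
    proj₁ (pair-⊇ (Cycle.pairs γ a≢v) (pairs {a} tt) (λ { (_ , e) → tt , e })
                  (tt , ~-sym (proj₂ (left-∈ π)))) refl
    where γ = sphere₁⇒cycle (punctured-embedding (embedding-unique embedding-id embedding-id)) τ

connected-resp : ∀ {G H} → G ≅ H → Connected H → Connected G
connected-resp {H = H} φ c =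
  linked⇒connected (≅⇒embedding φ) (proj₁ c , tt) (connected⇒linked embedding-id c)
  where open Cycles H

disk₁-connected : ∀ {G} → IsDisk₁ G → Connected G
disk₁-connected (S , σ , v , φ) = connected-resp φ (punctured-connected {S} σ v)

disk₁-not-sphere₁ : ∀ {G} → IsDisk₁ G → ¬ IsSphere₁ G
disk₁-not-sphere₁ {G} (S , σ , v , φ) τ =
  punctured-not-sphere₁ {S} σ v
    (cycle⇒sphere₁ (≅⇒embedding (≅-sym φ)) (sphere₁⇒cycle embedding-id τ))
  where open Cycles G

-- Contractibility of cones and arcs

module Contractions (H : Graph) where

  open Graph H using (_~_; _~?_; ~-sym; ~-irr)
  open Cycles H public
  open NonadjacentPair
  open Cycle

  contractible-point : ∀ p {y} → y ∈ p → (∀ {x} → x ∈ p → x ≡ y) → Contractible (induced H p)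
  contractible-point p {y} y∈p only-y = relabel (embedding-unique f (induced-embedding H p)) K₁
    where
    f : Embedding (edgeless 1) H (_∈ p)
    f = record
      { map⟨_⟩    = λ _ → y
      ; injective = λ { {zero} {zero} _ → refl }
      ; edge⁺     = λ ()
      ; edge⁻     = ~-irr refl
      ; image     = λ _ → y∈p
      ; covers    = λ x∈ → zero , sym (only-y x∈)
      }

  -- An ambient form of `pointAdd`. The rim of `y` in `A` is any `X` with the right members, so that
  -- a caller may supply a convenient set, such as a singleton.
  contractible-extend : ∀ A X {y} → y ∈ A → (∀ {x} → x ∈ X → x ∈ A × y ~ x) →
                        (∀ {x} → x ∈ A → y ~ x → x ∈ X) →
                        Contractible (induced H (A - y)) → Contractible (induced H X) →
                        Contractible (induced H A)
  contractible-extend A X {y} y∈A X⊆ ⊆X cA′ cX =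
    relabel (embedding-unique f (induced-embedding H A))
            (pointAdd q cA′ (relabel (embedding-unique (induced-embedding H X) g) cX))
    where
    A′ = A - y
    q  = restrict A′ X

    X⊆A′ : ∀ {x} → x ∈ X → x ∈ A′
    X⊆A′ x∈ = x∈p∧x≢y⇒x∈p-y (proj₁ (X⊆ x∈)) (λ { refl → ~-irr refl (proj₂ (X⊆ x∈)) })

    g : Embedding (induced (induced H A′) q) H (_∈ X)
    g = subspace-embedding (induced-embedding H A′) q (∈-restrict⁻ A′ X) X⊆A′ (∈-restrict⁺ A′ X)

    point : Fin (suc ∣ A′ ∣) → Point H
    point zero    = y
    point (suc i) = nth A′ i

    point≢y : ∀ i → nth A′ i ≢ y
    point≢y i = x∈p-y⇒x≢y {p = A} (nth-∈ A′ i)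

    new-edge⁺ : ∀ {i} → i ∈ q → y ~ nth A′ i
    new-edge⁺ i∈ = proj₂ (X⊆ (∈-restrict⁻ A′ X i∈))

    new-edge⁻ : ∀ {i} → y ~ nth A′ i → i ∈ q
    new-edge⁻ {i} e = ∈-restrict⁺ A′ X (⊆X (x∈p-y⇒x∈p (nth-∈ A′ i)) e)

    f : Embedding (addPoint (induced H A′) q) H (_∈ A)
    f = record
      { map⟨_⟩    = point
      ; injective = λ
          { {zero}  {zero}  _  → refl
          ; {zero}  {suc j} eq → contradiction (sym eq) (point≢y j)
          ; {suc i} {zero}  eq → contradiction eq (point≢y i)
          ; {suc i} {suc j} eq → cong suc (nth-injective A′ eq) }
      ; edge⁺     = λ
          { {zero}  {suc j} e → new-edge⁺ e
          ; {suc i} {zero}  e → ~-sym (new-edge⁺ e)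
          ; {suc i} {suc j} e → e }
      ; edge⁻     = λ
          { {zero}  {zero}  e → ~-irr refl e
          ; {zero}  {suc j} e → new-edge⁻ e
          ; {suc i} {zero}  e → new-edge⁻ (~-sym e)
          ; {suc i} {suc j} e → e }
      ; image     = λ { zero → y∈A ; (suc i) → x∈p-y⇒x∈p (nth-∈ A′ i) }
      ; covers    = covers′
      }
      where
      covers′ : ∀ {x} → x ∈ A → ∃[ i ] point i ≡ x
      covers′ {x} x∈ with x ≟ y
      ... | yes refl = zero , refl
      ... | no  x≢y with i , eq ← nth-surjective A′ (x∈p∧x≢y⇒x∈p-y x∈ x≢y) = suc i , eq

  -- For any `w` other than the apex, both `A - w` and the rim of `w` in `A` are smaller cones with
  -- the same apex.
  cone-contractible : ∀ A → Acc _⊂_ A → ∀ {v} → v ∈ A → (∀ {x} → x ∈ A → x ≢ v → v ~ x) →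
                      Contractible (induced H A)
  cone-contractible A (acc rs) {v} v∈A apex with any? (λ w → w ∈? A ×-dec ¬? (w ≟ v))
  ... | no none = contractible-point A v∈A only-v
    where
    only-v : ∀ {x} → x ∈ A → x ≡ v
    only-v {x} x∈ with x ≟ v
    ... | yes eq  = eq
    ... | no  x≢v = contradiction (x , x∈ , x≢v) none
  ... | yes (w , w∈A , w≢v) =
    contractible-extend A X w∈A X⇒ (λ x∈ e → ∈-comprehension⁺ X? (x∈ , e))
      (cone-contractible (A - w) (rs (x∈p⇒p-x⊂p w∈A)) (x∈p∧x≢y⇒x∈p-y v∈A (≢-sym w≢v))
                         (λ x∈ → apex (x∈p-y⇒x∈p x∈)))
      (cone-contractible X (rs (proj₁ ∘ X⇒ , w , w∈A , λ w∈X → ~-irr refl (proj₂ (X⇒ w∈X))))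
                         (∈-comprehension⁺ X? (v∈A , ~-sym (apex w∈A w≢v)))
                         (λ x∈ → apex (proj₁ (X⇒ x∈))))
    where
    X? = λ x → x ∈? A ×-dec w ~? x
    X  = comprehension X?
    X⇒ : ∀ {x} → x ∈ X → x ∈ A × w ~ x
    X⇒ = ∈-comprehension⁻ X?

  -- A point with a neighbour outside A is an end of the arc A.
  arc-contractible : ∀ {Q} → Cycle Q → ∀ A → Acc _⊂_ A → (∀ {x} → x ∈ A → Q x) →
                     ∀ {s t} → s ∈ A → Q t → t ∉ A → Linked (_∈ A) → Contractible (induced H A)
  arc-contractible {Q} γ A (acc rs) A⊆Q {t = t} s∈ qt t∉ linkedA
    with z , t′ , z∈A , t′∉A , e , qz , qt′ ← exit A (linked γ (A⊆Q s∈) qt) s∈ t∉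
    with any? (λ w → w ∈? A ×-dec ¬? (w ≟ z))
  ... | no none = contractible-point A z∈A only-z
    where
    only-z : ∀ {x} → x ∈ A → x ≡ z
    only-z {x} x∈ with x ≟ z
    ... | yes eq  = eq
    ... | no  x≢z = contradiction (x , x∈ , x≢z) none
  ... | yes (w , w∈A , w≢z) = shrink-arc (linkedA z∈A w∈A)
    where
    π : NonadjacentPair (λ x → Q x × z ~ x)
    π = pairs γ qz

    -- Of the two neighbours of `z` on the cycle one is `t′`, outside `A`, so at most one is left in
    -- `A`.
    end : ∀ {p x} → p ∈ A → x ∈ A → z ~ p → z ~ x → x ≡ p
    end {p} {x} p∈ x∈ e₁ e₂ with only π (qt′ , e) | only π (A⊆Q p∈ , e₁) | only π (A⊆Q x∈ , e₂)
    ... | _         | inj₁ eq  | inj₁ eq′ = trans eq′ (sym eq)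
    ... | _         | inj₂ eq  | inj₂ eq′ = trans eq′ (sym eq)
    ... | inj₁ refl | inj₁ refl | inj₂ _ = contradiction p∈ t′∉A
    ... | inj₂ refl | inj₁ _ | inj₂ refl = contradiction x∈ t′∉A
    ... | inj₁ refl | inj₂ _ | inj₁ refl = contradiction x∈ t′∉A
    ... | inj₂ refl | inj₂ refl | inj₁ _ = contradiction p∈ t′∉A

    shrink-arc : Walk (_∈ A) z w → Contractible (induced H A)
    shrink-arc ε = contradiction refl w≢z
    shrink-arc (_◅_ {j = p} (_ , z~p , p∈A) _) =
      contractible-extend A ⁅ p ⁆ z∈A
        (λ x∈ → subst (λ u → u ∈ A × z ~ u) (sym (x∈⁅y⁆⇒x≡y p x∈)) (p∈A , z~p))
        (λ x∈ z~x → subst (_∈ ⁅ p ⁆) (sym (end p∈A x∈ z~p z~x)) (x∈⁅x⁆ p))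
        (arc-contractible γ (A - z) (rs (x∈p⇒p-x⊂p z∈A)) (λ x∈ → A⊆Q (x∈p-y⇒x∈p x∈))
          (x∈p∧x≢y⇒x∈p-y w∈A w≢z) qt (λ t∈ → t∉ (x∈p-y⇒x∈p t∈))
          (linked-resp (λ { (x∈ , x≢z) → x∈p∧x≢y⇒x∈p-y x∈ x≢z })
                       (λ x∈ → x∈p-y⇒x∈p x∈ , x∈p-y⇒x≢y {p = A} x∈)
                       (linked-delete z linkedA rim-linked)))
        (contractible-point ⁅ p ⁆ (x∈⁅x⁆ p) (x∈⁅y⁆⇒x≡y p))
      where
      rim-linked : Linked (λ x → x ∈ A × z ~ x)
      rim-linked (x∈ , e₁) (y∈ , e₂) with end p∈A x∈ z~p e₁ | end p∈A y∈ z~p e₂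
      ... | refl | refl = ε

-- Induced paths and the cycles they close up to

module InducedPaths (H : Graph) where

  open Graph H using (_~_; _~?_; ~-sym; ~-irr)
  open Contractions H public
  open NonadjacentPair

  insert : Point H → Subset (order H) → Subset (order H)
  insert c S = ⁅ c ⁆ ∪ S

  ∈-insert⁻ : ∀ {c z} S → z ∈ insert c S → z ≡ c ⊎ z ∈ S
  ∈-insert⁻ {c} S z∈ with x∈p∪q⁻ ⁅ c ⁆ S z∈
  ... | inj₁ z∈c = inj₁ (x∈⁅y⁆⇒x≡y c z∈c)
  ... | inj₂ z∈S = inj₂ z∈S

  new∈insert : ∀ {c} S → c ∈ insert c S
  new∈insert {c} S = p⊆p∪q S (x∈⁅x⁆ c)

  old∈insert : ∀ {c z} S → z ∈ S → z ∈ insert c S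
  old∈insert {c} S = q⊆p∪q ⁅ c ⁆ S

  -- S consists of the points of an induced path from the second index to the third.
  data InducedPath : Subset (order H) → Point H → Point H → Set where
    single : ∀ a → InducedPath ⁅ a ⁆ a a
    extend : ∀ {S a b} c → c ∉ S → c ~ a → (∀ {z} → z ∈ S → c ~ z → z ≡ a) →
             InducedPath S a b → InducedPath (insert c S) c b

  first∈ : ∀ {S a b} → InducedPath S a b → a ∈ S
  first∈ (single a)           = x∈⁅x⁆ a
  first∈ (extend {S} c _ _ _ _) = new∈insert S

  last∈ : ∀ {S a b} → InducedPath S a b → b ∈ S
  last∈ (single a)             = x∈⁅x⁆ a
  last∈ (extend {S} c _ _ _ π) = old∈insert S (last∈ π)

  along : ∀ {S a b} → InducedPath S a b → ∀ {z} → z ∈ S → Walk (_∈ S) a z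
  along (single a) z∈ = subst (Walk _ a) (sym (x∈⁅y⁆⇒x≡y a z∈)) ε
  along (extend {S} c _ e _ π) z∈ with ∈-insert⁻ S z∈
  ... | inj₁ refl = ε
  ... | inj₂ z∈S  =
    (new∈insert S , e , old∈insert S (first∈ π)) ◅ walk-map (old∈insert S) (along π z∈S)

  End : Subset (order H) → Point H → Set
  End S a = ∃[ a′ ] (a′ ∈ S × a ~ a′ × (∀ {z} → z ∈ S → a ~ z → z ≡ a′))

  Inner : Subset (order H) → Point H → Set
  Inner S u = NonadjacentPair (λ z → z ∈ S × u ~ z)

  -- The local picture needed to close up a path. It is inherited along `extend`, because a new
  -- first point adds a neighbour to the old first point only. A one-point path stands apart, its
  -- ends being one point without neighbours.
  data Degrees (S : Subset (order H)) (a b : Point H) : Set where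
    trivial : a ≡ b → (∀ {z} → z ∈ S → z ≡ a) → Degrees S a b
    proper  : a ≢ b → End S a → End S b → (∀ {u} → u ∈ S → u ≢ a → u ≢ b → Inner S u) →
              Degrees S a b

  end⇒inner : ∀ {S a c} (η : End S a) → c ∉ S → c ~ a → ¬ (c ~ proj₁ η) → Inner (insert c S) a
  end⇒inner {S} {a} {c} (a′ , a′∈ , e , only-a′) c∉ c~a c≁a′ = record
    { left        = c
    ; right       = a′
    ; distinct    = λ { refl → c∉ a′∈ }
    ; nonadjacent = c≁a′
    ; left-∈      = new∈insert S , ~-sym c~a
    ; right-∈     = old∈insert S a′∈ , e
    ; only        = λ { (z∈ , e) → only′ (∈-insert⁻ S z∈) e }
    }
    where
    only′ : ∀ {z} → z ≡ c ⊎ z ∈ S → a ~ z → z ≡ c ⊎ z ≡ a′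
    only′ (inj₁ eq) _ = inj₁ eq
    only′ (inj₂ z∈) e = inj₂ (only-a′ z∈ e)

  module _ {S : Subset (order H)} {c u : Point H} (c≁u : ¬ (c ~ u)) where

    old-neighbour : ∀ {z} → z ∈ insert c S → u ~ z → z ∈ S
    old-neighbour z∈ e with ∈-insert⁻ S z∈
    ... | inj₁ refl = contradiction (~-sym e) c≁u
    ... | inj₂ z∈S  = z∈S

    inner-insert : Inner S u → Inner (insert c S) u
    inner-insert =
      pair-resp (λ { (z∈ , e) → old∈insert S z∈ , e }) (λ { (z∈ , e) → old-neighbour z∈ e , e })

    end-insert : End S u → End (insert c S) u
    end-insert (u′ , u′∈ , e , only-u′) =
      u′ , old∈insert S u′∈ , e , λ z∈ e′ → only-u′ (old-neighbour z∈ e′) e′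

  degrees : ∀ {S a b} → InducedPath S a b → Degrees S a b
  degrees (single a) = trivial refl (x∈⁅y⁆⇒x≡y a)
  degrees (extend {S} {a} {b} c c∉ c~a only-a π) = step (degrees π)
    where
    endᶜ : End (insert c S) c
    endᶜ = a , old∈insert S (first∈ π) , c~a , λ z∈ e → only′ (∈-insert⁻ S z∈) e
      where
      only′ : ∀ {z} → z ≡ c ⊎ z ∈ S → c ~ z → z ≡ a
      only′ (inj₁ refl) e = contradiction e (~-irr refl)
      only′ (inj₂ z∈)   e = only-a z∈ e

    b≢c : b ≢ c
    b≢c refl = c∉ (last∈ π)

    step : Degrees S a b → Degrees (insert c S) c b
    step (trivial refl only) = proper (≢-sym b≢c) endᶜ endᵃ inner
      where
      endᵃ : End (insert c S) a
      endᵃ = c , new∈insert S , ~-sym c~a , λ z∈ e → only′ (∈-insert⁻ S z∈) e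
        where
        only′ : ∀ {z} → z ≡ c ⊎ z ∈ S → a ~ z → z ≡ c
        only′ (inj₁ eq) _ = eq
        only′ (inj₂ z∈) e = contradiction e (~-irr (sym (only z∈)))

      inner : ∀ {u} → u ∈ insert c S → u ≢ c → u ≢ a → Inner (insert c S) u
      inner u∈ u≢c u≢a with ∈-insert⁻ S u∈
      ... | inj₁ eq  = contradiction eq u≢c
      ... | inj₂ u∈S = contradiction (only u∈S) u≢a
    step (proper a≢b endᵃ endᵇ innerS) = proper (≢-sym b≢c) endᶜ (end-insert c≁b endᵇ) inner
      where
      a′≢a : proj₁ endᵃ ≢ a
      a′≢a eq = ~-irr (sym eq) (proj₁ (proj₂ (proj₂ endᵃ)))

      c≁b : ¬ (c ~ b)
      c≁b e = a≢b (sym (only-a (last∈ π) e))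

      inner : ∀ {u} → u ∈ insert c S → u ≢ c → u ≢ b → Inner (insert c S) u
      inner {u} u∈ u≢c u≢b with ∈-insert⁻ S u∈
      ... | inj₁ eq  = contradiction eq u≢c
      ... | inj₂ u∈S with u ≟ a
      ...   | yes refl = end⇒inner endᵃ c∉ c~a λ e → a′≢a (only-a (proj₁ (proj₂ endᵃ)) e)
      ...   | no  u≢a  = inner-insert (λ e → u≢a (only-a u∈S e)) (innerS u∈S u≢a u≢b)

  -- Closing up affects the two ends alone: each gains `y` as its second neighbour. That `a` and `b`
  -- are nonadjacent excludes a triangle.
  close-cycle : ∀ {S a b y} → InducedPath S a b → y ∉ S → y ~ a → y ~ b → a ≢ b → ¬ (a ~ b) →
                (∀ {z} → z ∈ S → y ~ z → z ≡ a ⊎ z ≡ b) → Cycle (_∈ insert y S)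
  close-cycle {S} {a} {b} {y} π y∉ y~a y~b a≢b a≁b only-ab = close (degrees π)
    where
    close : Degrees S a b → Cycle (_∈ insert y S)
    close (trivial a≡b _) = contradiction a≡b a≢b
    close (proper _ endᵃ endᵇ inner) = record
      { nonempty = y , new∈insert S
      ; linked   = linked-via a from-a
      ; pairs    = λ u∈ → pairs′ (∈-insert⁻ S u∈)
      }
      where
      from-a : ∀ {z} → z ∈ insert y S → Walk (_∈ insert y S) a z
      from-a z∈ with ∈-insert⁻ S z∈
      ... | inj₁ refl = (old∈insert S (first∈ π) , ~-sym y~a , new∈insert S) ◅ ε
      ... | inj₂ z∈S  = walk-map (old∈insert S) (along π z∈S)

      pair-y : Inner (insert y S) y
      pair-y = record
        { left = a ; right = b ; distinct = a≢b ; nonadjacent = a≁b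
        ; left-∈  = old∈insert S (first∈ π) , y~a
        ; right-∈ = old∈insert S (last∈ π) , y~b
        ; only    = λ { (z∈ , e) → only′ (∈-insert⁻ S z∈) e }
        }
        where
        only′ : ∀ {z} → z ≡ y ⊎ z ∈ S → y ~ z → z ≡ a ⊎ z ≡ b
        only′ (inj₁ refl) e = contradiction e (~-irr refl)
        only′ (inj₂ z∈)   e = only-ab z∈ e

      -- The point next to the end `u` is not `u`, and it is not the other end `v`, to which `u` is
      -- not adjacent; so `y` does not see it.
      second≁y : ∀ {u v} (η : End S u) → ¬ (u ~ v) →
                 (∀ {z} → z ∈ S → y ~ z → z ≡ u ⊎ z ≡ v) → ¬ (y ~ proj₁ η)
      second≁y (u′ , u′∈ , e , _) u≁v only-uv y~u′ with only-uv u′∈ y~u′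
      ... | inj₁ refl = ~-irr refl e
      ... | inj₂ refl = u≁v e

      pairs′ : ∀ {u} → u ≡ y ⊎ u ∈ S → Inner (insert y S) u
      pairs′ (inj₁ refl) = pair-y
      pairs′ {u} (inj₂ u∈) with u ≟ a | u ≟ b
      ... | yes refl | _        = end⇒inner endᵃ y∉ y~a (second≁y endᵃ a≁b only-ab)
      ... | no _     | yes refl = 
        end⇒inner endᵇ y∉ y~b (second≁y endᵇ (λ e → a≁b (~-sym e)) (λ z∈ e → swap (only-ab z∈ e)))
      ... | no u≢a   | no u≢b   =
        inner-insert (λ e → outside-ends (only-ab u∈ e)) (inner u∈ u≢a u≢b)
        where
        outside-ends : ¬ (u ≡ a ⊎ u ≡ b)
        outside-ends (inj₁ eq) = u≢a eq
        outside-ends (inj₂ eq) = u≢b eq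

  suffix : ∀ {S a b c} → InducedPath S a b → c ∈ S → ∃[ S′ ] (S′ ⊆ S × InducedPath S′ c b)
  suffix {c = c} (single a) c∈ with x∈⁅y⁆⇒x≡y a c∈
  ... | refl = ⁅ a ⁆ , id , single a
  suffix (extend {S} c c∉ e only-a π) c∈ with ∈-insert⁻ S c∈
  ... | inj₁ refl = insert c S , id , extend c c∉ e only-a π
  ... | inj₂ c∈S with S′ , S′⊆S , π′ ← suffix π c∈S = S′ , old∈insert S ∘ S′⊆S , π′

  -- c is attached to the last point of the path that it is adjacent to.
  attach : ∀ {S a b c z} → InducedPath S a b → c ∉ S → z ∈ S → c ~ z →
           ∃[ S′ ] (S′ ⊆ insert c S × InducedPath S′ c b)
  attach {c = c} (single a) c∉ z∈ e with x∈⁅y⁆⇒x≡y a z∈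
  ... | refl = insert c ⁅ a ⁆ , id , extend c c∉ e (λ z′∈ _ → x∈⁅y⁆⇒x≡y a z′∈) (single a)
  attach {c = c} (extend {S} a a∉ e only-a π) c∉ z∈ c~z
    with any? (λ w → w ∈? S ×-dec c ~? w)
  ... | yes (w , w∈ , c~w) with S′ , S′⊆ , π′ ← attach π (c∉ ∘ old∈insert S) w∈ c~w =
    S′ , (λ x∈ → lift (∈-insert⁻ S (S′⊆ x∈))) , π′
    where
    lift : ∀ {x} → x ≡ c ⊎ x ∈ S → x ∈ insert c (insert a S)
    lift (inj₁ refl) = new∈insert (insert a S)
    lift (inj₂ x∈)   = old∈insert (insert a S) (old∈insert S x∈)
  ... | no none =
    insert c (insert a S) , id ,
    extend c c∉ (subst (c ~_) (is-a z∈ c~z) c~z) is-a (extend a a∉ e only-a π)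
    where
    is-a : ∀ {x} → x ∈ insert a S → c ~ x → x ≡ a
    is-a x∈ c~x with ∈-insert⁻ S x∈
    ... | inj₁ eq  = eq
    ... | inj₂ x∈S = contradiction (_ , x∈S , c~x) none

  walk⇒induced-path : ∀ {P a b} → P a → Walk P a b →
                      ∃[ S ] ((∀ {z} → z ∈ S → P z) × InducedPath S a b)
  walk⇒induced-path {P} {a} pa ε = ⁅ a ⁆ , (λ z∈ → subst P (sym (x∈⁅y⁆⇒x≡y a z∈)) pa) , single a
  walk⇒induced-path {P} {a} _ ((pa , e , pc) ◅ w)
    with S , S⊆P , π ← walk⇒induced-path pc w
    with a ∈? S
  ... | yes a∈ with S′ , S′⊆S , π′ ← suffix π a∈ = S′ , S⊆P ∘ S′⊆S , π′
  ... | no  a∉ with S′ , S′⊆ , π′ ← attach π a∉ (first∈ π) e =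
    S′ , (λ z∈ → lift (∈-insert⁻ S (S′⊆ z∈))) , π′
    where
    lift : ∀ {x} → x ≡ a ⊎ x ∈ S → P x
    lift (inj₁ refl) = pa
    lift (inj₂ x∈)   = S⊆P x∈

-- Rims in a disk that belongs to the graph

module Disks (H : Graph) where

  open Graph H using (_~_)
  open InducedPaths H public

  module _ {d s : Subset (order H)} (Δ : DiskIn H d s) where

    open DiskIn Δ
    open IsDisk₂ isDisk

    -- Of the 1-disk only two facts will be used, that it is connected and that it is not a
    -- 1-sphere. Both concern the graph `A` itself, so no ambient form of 1-disks is introduced.
    disk-rim-boundary : ∀ {y} → y ∈ s →
                        ∃[ A ] (Embedding A H (λ z → z ∈ d × y ~ z) × IsDisk₁ A)
    disk-rim-boundary y∈s with nth-surjective d (boundary⊆disk y∈s)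
    ... | i , refl = rim (induced H d) i , rim-embedding (induced-embedding H d) i ,
                     boundary-rims i (∈-restrict⁺ d s y∈s)

    disk-rim-interior : ∀ {u} → u ∈ d → u ∉ s → Cycle (λ z → z ∈ d × u ~ z)
    disk-rim-interior u∈d u∉s with nth-surjective d u∈d
    ... | i , refl = sphere₁⇒cycle (rim-embedding (induced-embedding H d) i)
                       (interior-rims i (x∉p⇒x∈∁p (u∉s ∘ ∈-restrict⁻ d s)))

-- Removing the points of a region one by one

module Shelling (H : Graph) (manifold : IsManifold₂ H)
                (bound : ∀ S → IsSphere₁ (induced H S) → ∃[ D ] DiskIn H D S) where

  open Graph H using (_~_; _~?_; ~-sym; ~-irr)
  open Disks H
  open Cycle

  rim-cycle : ∀ v → Cycle (v ~_)
  rim-cycle v = cycle-resp (∈-neighbours⁻ H) (∈-neighbours⁺ H)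
                  (sphere₁⇒cycle (induced-embedding H (neighbours H v)) (proj₂ manifold v))

  rim-delete : ∀ v {o} → v ~ o → Linked (λ z → v ~ z × z ≢ o)
  rim-delete v v~o =
    linked-resp (λ { (z∈ , z≢o) → ∈-neighbours⁻ H z∈ , z≢o })
                (λ { (e , z≢o) → ∈-neighbours⁺ H e , z≢o })
      (cycle-delete (neighbours H v)
        (cycle-resp (∈-neighbours⁺ H) (∈-neighbours⁻ H) (rim-cycle v)) (∈-neighbours⁺ H v~o))

  all-linked : Linked (λ _ → ⊤)
  all-linked = connected⇒linked embedding-id (proj₁ manifold)

  -- The separation property: one leaves a disk only through its boundary. By `cycle-⊇` the rim of
  -- `u` in the disk is its whole rim in `H`.
  interior-closed : ∀ {d s} → DiskIn H d s → ∀ {u z} → u ∈ d → u ∉ s → u ~ z → z ∈ d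
  interior-closed Δ u∈d u∉s e =
    proj₁ (cycle-⊇ (disk-rim-interior Δ u∈d u∉s) (rim-cycle _) proj₂ e)

  module _ (U : Subset (order H)) {r : Point H} (r∉U : r ∉ U) (rest-linked : Linked (_∉ U)) where

    OnRim : Point H → Point H → Set
    OnRim y z = z ∈ U × y ~ z

    -- The complement of U lies on one side of the boundary of the disk.  If it
    -- lies outside, a and b are joined by the rim of y in the disk, otherwise by
    -- the rest of the rim of y in H.
    module _ {d s} (Δ : DiskIn H d s) (s⊆U : s ⊆ U) {y} (y∈s : y ∈ s) where

      private
        d∖U-interior : ∀ {z} → z ∉ U → z ∉ s
        d∖U-interior z∉U z∈s = z∉U (s⊆U z∈s)

      -- A walk off `U` avoids `s`, so on entering `d` it would reach an interior point that has a
      -- neighbour outside `d`.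
      stay-out : ∀ {x z} → x ∉ d → Walk (_∉ U) x z → z ∉ d
      stay-out x∉d ε = x∉d
      stay-out x∉d ((_ , e , z∉U) ◅ w) =
        stay-out (λ z∈d → x∉d (interior-closed Δ z∈d (d∖U-interior z∉U) (~-sym e))) w

      stay-in : ∀ {x z} → x ∈ d → Walk (_∉ U) x z → z ∈ d
      stay-in x∈d ε = x∈d
      stay-in x∈d ((x∉U , e , _) ◅ w) = stay-in (interior-closed Δ x∈d (d∖U-interior x∉U) e) w

      module _ {a b} (y~a : y ~ a) (y~b : y ~ b) (a∈s : a ∈ s) (b∈s : b ∈ s) (a≢b : a ≢ b)
               (only-ab : ∀ {z} → z ∈ s → y ~ z → z ≡ a ⊎ z ≡ b) where

        arc-inside : r ∉ d → Walk (OnRim y) a b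
        arc-inside r∉d =
          walk-map (λ { (z∈d , e) → d⊆U z∈d , e })
            (connected⇒linked f (disk₁-connected disk₁) (s⊆d a∈s , y~a) (s⊆d b∈s , y~b))
          where
          s⊆d = DiskIn.boundary⊆disk Δ
          f = proj₁ (proj₂ (disk-rim-boundary Δ y∈s))
          disk₁ = proj₂ (proj₂ (disk-rim-boundary Δ y∈s))

          d⊆U : ∀ {z} → z ∈ d → z ∈ U
          d⊆U {z} z∈d with z ∈? U
          ... | yes z∈U = z∈U
          ... | no  z∉U = contradiction z∈d (stay-out r∉d (rest-linked r∉U z∉U))

        arc-outside : r ∈ d → Walk (OnRim y) a b
        arc-outside r∈d with any? (λ z → y ~? z ×-dec ¬? (z ∈? d))
        -- If all of the rim of `y` were in the disk, the rim of this boundary point in the disk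
        -- would be a 1-sphere.
        ... | no none =
          contradiction (cycle⇒sphere₁ f (cycle-resp (λ e → rim⊆d e , e) proj₂ (rim-cycle y)))
                        (disk₁-not-sphere₁ disk₁)
          where
          f = proj₁ (proj₂ (disk-rim-boundary Δ y∈s))
          disk₁ = proj₂ (proj₂ (disk-rim-boundary Δ y∈s))

          rim⊆d : ∀ {z} → y ~ z → z ∈ d
          rim⊆d {z} e with z ∈? d
          ... | yes z∈d = z∈d
          ... | no  z∉d = contradiction (z , e , z∉d) none
        ... | yes (z , y~z , z∉d) =
          -- From `z`, off the disk, one goes around the rim of `y` in both directions: avoiding `b`
          -- one arrives at `a`, avoiding `a` at `b`.
          walk-reverse (reach z∉d only-a (rim-delete y y~b (y~z , z≢ b∈s) (y~a , a≢b)))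
          ◅◅ reach z∉d only-b (rim-delete y y~a (y~z , z≢ a∈s) (y~b , ≢-sym a≢b))
          where
          s⊆d = DiskIn.boundary⊆disk Δ

          z≢ : ∀ {u} → u ∈ s → z ≢ u
          z≢ u∈s refl = z∉d (s⊆d u∈s)

          only-a : ∀ {z} → z ∈ s → y ~ z → z ≢ b → z ≡ a
          only-a z∈ e z≢b with only-ab z∈ e
          ... | inj₁ eq = eq
          ... | inj₂ eq = contradiction eq z≢b

          only-b : ∀ {z} → z ∈ s → y ~ z → z ≢ a → z ≡ b
          only-b z∈ e z≢a with only-ab z∈ e
          ... | inj₁ eq = contradiction eq z≢a
          ... | inj₂ eq = eq

          off-disk : ∀ {z} → z ∉ d → z ∈ U
          off-disk {z} z∉d with z ∈? U
          ... | yes z∈U = z∈U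
          ... | no  z∉U = contradiction (stay-in r∈d (rest-linked r∉U z∉U)) z∉d

          -- The walk starts off the disk and can enter it only at a boundary point. On this rim,
          -- with `o` avoided, the only such point is `t`, so the walk is stopped there; all points
          -- before it are off the disk and hence in `U`.
          reach : ∀ {x t o} → x ∉ d → (∀ {z} → z ∈ s → y ~ z → z ≢ o → z ≡ t) →
                  Walk (λ z → y ~ z × z ≢ o) x t → Walk (OnRim y) x t
          reach x∉d only-t ε = ε
          reach x∉d only-t (_◅_ {j = z} ((y~x , _) , e , y~z , z≢o) w) with z ∈? d
          ... | no  z∉d = ((off-disk x∉d , y~x) , e , off-disk z∉d , y~z) ◅ reach z∉d only-t w
          ... | yes z∈d with z ∈? s
          ...   | no  z∉s = contradiction (interior-closed Δ z∈d z∉s (~-sym e)) x∉d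
          ...   | yes z∈s with only-t z∈s y~z z≢o
          ...     | refl = ((off-disk x∉d , y~x) , e , s⊆U z∈s , y~z) ◅ ε

        arc : Walk (OnRim y) a b
        arc with r ∈? d
        ... | yes r∈d = arc-outside r∈d
        ... | no  r∉d = arc-inside r∉d

    module _ {y : Point H} (y∈U : y ∈ U) where

      -- The path up to its first point h on the rim of y, and the rest of the
      -- path pushed into the rim.
      first-hit : ∀ {S x b} → InducedPath S x b → (∀ {z} → z ∈ S → z ∈ U × z ≢ y) → y ~ b →
                  ∃[ h ] ∃[ S′ ] (S′ ⊆ S × InducedPath S′ x h × y ~ h ×
                                  (∀ {z} → z ∈ S′ → y ~ z → z ≡ h) × Walk (OnRim y) h b)
      first-hit (single b) _ y~b = b , ⁅ b ⁆ , id , single b , y~b , (λ z∈ _ → x∈⁅y⁆⇒x≡y b z∈) , ε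
      first-hit (extend {S} {a} c c∉ e only-a π) S⊆ y~b
        with h , S′ , S′⊆S , π′ , y~h , only-h , w ← first-hit π (S⊆ ∘ old∈insert S) y~b
        with y ~? c
      ... | no y≁c =
        h , insert c S′ , (λ z∈ → widen (∈-insert⁻ S′ z∈)) ,
        extend c (c∉ ∘ S′⊆S) e (only-a ∘ S′⊆S) π′ , y~h , (λ z∈ → only-h′ (∈-insert⁻ S′ z∈)) , w
        where
        widen : ∀ {z} → z ≡ c ⊎ z ∈ S′ → z ∈ insert c S
        widen (inj₁ refl) = new∈insert S
        widen (inj₂ z∈)   = old∈insert S (S′⊆S z∈)

        only-h′ : ∀ {z} → z ≡ c ⊎ z ∈ S′ → y ~ z → z ≡ h
        only-h′ (inj₁ refl) y~c = contradiction y~c y≁c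
        only-h′ (inj₂ z∈)   y~z = only-h z∈ y~z
      ... | yes y~c =
        c , ⁅ c ⁆ , (λ z∈ → subst (_∈ insert c S) (sym (x∈⁅y⁆⇒x≡y c z∈)) (new∈insert S)) ,
        single c , y~c , (λ z∈ _ → x∈⁅y⁆⇒x≡y c z∈) , hop ◅◅ w
        where
        h∈S = S′⊆S (last∈ π′)
        c∈U = proj₁ (S⊆ (new∈insert S))
        h∈U = proj₁ (S⊆ (old∈insert S h∈S))

        -- Here `c` and `h` are consecutive meetings with the rim. Either they are adjacent, or the
        -- portion of the path between them closes up through `y` to a 1-sphere, as no other point
        -- of it is adjacent to `y`.
        hop : Walk (OnRim y) c h
        hop with c ~? h
        ... | yes c~h = ((c∈U , y~c) , c~h , h∈U , y~h) ◅ ε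
        ... | no  c≁h =
          arc (proj₂ (bound s (cycle⇒sphere₁ (induced-embedding H s) cycle)))
              (λ z∈ → s⊆U (∈-insert⁻ T z∈)) (new∈insert T) y~c y~h
              (old∈insert T (new∈insert S′)) (old∈insert T (old∈insert S′ (last∈ π′)))
              c≢h (λ z∈ y~z → only-ends (∈-insert⁻ T z∈) y~z)
          where
          T = insert c S′
          s = insert y T

          c≢h : c ≢ h
          c≢h refl = c∉ h∈S

          T⊆ : ∀ {z} → z ∈ T → z ∈ U × z ≢ y
          T⊆ z∈ with ∈-insert⁻ S′ z∈
          ... | inj₁ refl = S⊆ (new∈insert S)
          ... | inj₂ z∈S′ = S⊆ (old∈insert S (S′⊆S z∈S′))

          s⊆U : ∀ {z} → z ≡ y ⊎ z ∈ T → z ∈ U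
          s⊆U (inj₁ refl) = y∈U
          s⊆U (inj₂ z∈)   = proj₁ (T⊆ z∈)

          ends : ∀ {z} → z ∈ T → y ~ z → z ≡ c ⊎ z ≡ h
          ends z∈ y~z with ∈-insert⁻ S′ z∈
          ... | inj₁ eq   = inj₁ eq
          ... | inj₂ z∈S′ = inj₂ (only-h z∈S′ y~z)

          only-ends : ∀ {z} → z ≡ y ⊎ z ∈ T → y ~ z → z ≡ c ⊎ z ≡ h
          only-ends (inj₁ refl) y~y = contradiction y~y (~-irr refl)
          only-ends (inj₂ z∈)   y~z = ends z∈ y~z

          cycle : Cycle (_∈ s)
          cycle = close-cycle (extend c (c∉ ∘ S′⊆S) e (only-a ∘ S′⊆S) π′)
                    (λ y∈ → proj₂ (T⊆ y∈) refl) y~c y~h c≢h c≁h ends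

      rim-linked : Linked (λ z → z ∈ U × z ≢ y) → Linked (OnRim y)
      rim-linked l {p} (p∈U , y~p) (q∈U , y~q) =
        go y~q (walk⇒induced-path p∈ (l p∈ (q∈U , rim≢ y~q)))
        where
        rim≢ : ∀ {z} → y ~ z → z ≢ y
        rim≢ e refl = ~-irr refl e

        p∈ = p∈U , rim≢ y~p

        go : ∀ {q} → y ~ q → ∃[ S ] ((∀ {z} → z ∈ S → z ∈ U × z ≢ y) × InducedPath S p q) →
             Walk (OnRim y) p q
        go y~q (S , S⊆ , π) with h , S′ , _ , π′ , _ , only-h , w ← first-hit π S⊆ y~q
          -- The path starts on the rim, so its first meeting with the rim is `p` itself.
          with only-h (first∈ π′) y~p
        ... | refl = w

    Frontier : Point H → Set
    Frontier y = y ∈ U × ∃[ t ] (t ∉ U × y ~ t)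

    module _ (U-linked : Linked (_∈ U)) where

      -- Going around the rim of y from a point of W to a point outside U, one leaves W next to a
      -- point that is outside U as well.
      frontier-of-part : ∀ W {y w} → Frontier y → y ∉ W → W ⊆ U → w ∈ W →
                         (∀ {z u} → z ∈ W → u ∈ U → z ~ u → u ≡ y ⊎ u ∈ W) →
                         ∃[ v ] (v ∈ W × Frontier v)
      frontier-of-part W {y} (y∈U , t , t∉U , y~t) y∉W W⊆U w∈W closedW
        with w₁ , z , w₁∈W , z∉W , w₁~z , _ , z∈U ← exit W (U-linked (W⊆U w∈W) y∈U) w∈W y∉W
        with closedW w₁∈W z∈U w₁~z
      ... | inj₂ z∈W = contradiction z∈W z∉W
      ... | inj₁ refl
        with v , t′ , v∈W , t′∉W , v~t′ , _ , y~t′ ←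
               exit W (linked (rim-cycle y) (~-sym w₁~z) y~t) w₁∈W (t∉U ∘ W⊆U)
        = v , v∈W , W⊆U v∈W , t′ , (λ t′∈U → not-in (closedW v∈W t′∈U v~t′)) , v~t′
        where
        not-in : ¬ (t′ ≡ y ⊎ t′ ∈ W)
        not-in (inj₁ refl) = ~-irr refl y~t′
        not-in (inj₂ t′∈W) = t′∉W t′∈W

      -- W is a union of components of U - y.  If its frontier point v is a cut point
      -- of U, the components of U - v that avoid y lie in W - v.
      noncut-frontier-of-part :
        ∀ W → Acc _⊂_ W → ∀ {y w} → Frontier y → y ∉ W → W ⊆ U → w ∈ W →
        (∀ {z u} → z ∈ W → u ∈ U → z ~ u → u ≡ y ⊎ u ∈ W) →
        Linked (λ z → z ∈ U × z ∉ W) →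
        ∃[ v ] (Frontier v × Linked (λ z → z ∈ U × z ≢ v))
      noncut-frontier-of-part W (acc rs) {y} fy@(y∈U , _) y∉W W⊆U w∈W closedW rest
        with v , v∈W , fv ← frontier-of-part W fy y∉W W⊆U w∈W closedW
        = choose (any? λ z → W′? z)
        where
        y∈U-v : y ∈ U - v
        y∈U-v = x∈p∧x≢y⇒x∈p-y y∈U λ { refl → y∉W v∈W }

        open Component (component (U - v) y∈U-v) renaming (points to V)

        W′? : ∀ z → Dec (z ∈ U × z ≢ v × z ∉ V)
        W′? z = z ∈? U ×-dec ¬? (z ≟ v) ×-dec ¬? (z ∈? V)

        W′ = comprehension W′?

        V⊆U : ∀ {z} → z ∈ V → z ∈ U
        V⊆U z∈ = x∈p-y⇒x∈p (within z∈)

        V≢v : ∀ {z} → z ∈ V → z ≢ v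
        V≢v z∈ = x∈p-y⇒x≢y {p = U} (within z∈)

        close : ∀ {z u} → z ∈ V → u ∈ U → u ≢ v → z ~ u → u ∈ V
        close z∈ u∈ u≢v = closed z∈ (x∈p∧x≢y⇒x∈p-y u∈ u≢v)

        -- A point of `U` outside `W` is joined to `y` off `W`, hence off `v`, and so falls into the
        -- component `V`. This is why `W′` stays within `W`.
        outside-W : ∀ {z} → z ∈ U → z ∉ W → z ∈ V
        outside-W z∈U z∉W = follow base (rest (y∈U , y∉W) (z∈U , z∉W))
          where
          follow : ∀ {a b} → a ∈ V → Walk (λ z → z ∈ U × z ∉ W) a b → b ∈ V
          follow a∈ ε = a∈
          follow a∈ ((_ , e , c∈U , c∉W) ◅ k) = follow (close a∈ c∈U (λ { refl → c∉W v∈W }) e) k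

        W′⊆W : W′ ⊆ W
        W′⊆W {z} z∈ with ∈-comprehension⁻ W′? z∈ | z ∈? W
        ... | _               | yes z∈W = z∈W
        ... | z∈U , _ , z∉V   | no  z∉W = contradiction (outside-W z∈U z∉W) z∉V

        v∉W′ : v ∉ W′
        v∉W′ v∈ = proj₁ (proj₂ (∈-comprehension⁻ W′? v∈)) refl

        closedW′ : ∀ {z u} → z ∈ W′ → u ∈ U → z ~ u → u ≡ v ⊎ u ∈ W′
        closedW′ {z} {u} z∈ u∈U e with ∈-comprehension⁻ W′? z∈ | u ≟ v | u ∈? V
        ... | _               | yes eq  | _      = inj₁ eq
        ... | z∈U , z≢v , z∉V | no _    | yes u∈V = contradiction (close u∈V z∈U z≢v (~-sym e)) z∉V
        ... | _               | no u≢v  | no u∉V = inj₂ (∈-comprehension⁺ W′? (u∈U , u≢v , u∉V))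

        V-outside : ∀ {z} → z ∈ V → z ∈ U × z ∉ W′
        V-outside z∈ = V⊆U z∈ , λ z∈W′ → proj₂ (proj₂ (∈-comprehension⁻ W′? z∈W′)) z∈

        -- In the recursion `v` takes the place of `y`, and what is left of `U` outside `W′`, namely
        -- `V` together with `v`, must again be linked.
        v-adjacent : ∃[ c ] (c ∈ V × c ~ v)
        v-adjacent
          with c , u , c∈V , u∉V , c~u , _ , u∈U ←
                 exit V (U-linked y∈U (W⊆U v∈W)) base (λ v∈V → V≢v v∈V refl)
          with u ≟ v
        ... | yes refl = c , c∈V , c~u
        ... | no  u≢v  = contradiction (close c∈V u∈U u≢v c~u) u∉V

        rest′ : Linked (λ z → z ∈ U × z ∉ W′)
        rest′ = linked-via y from-y
          where
          from-y : ∀ {z} → z ∈ U × z ∉ W′ → Walk (λ z → z ∈ U × z ∉ W′) y z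
          from-y {z} (z∈U , z∉W′) with z ∈? V | z ≟ v
          ... | yes z∈V | _ = walk-map V-outside (walks z∈V)
          ... | no z∉V  | no z≢v = contradiction (∈-comprehension⁺ W′? (z∈U , z≢v , z∉V)) z∉W′
          ... | no _    | yes refl with c , c∈V , c~v ← v-adjacent =
            walk-map V-outside (walks c∈V) ◅◅ (V-outside c∈V , c~v , z∈U , z∉W′) ◅ ε

        choose : Dec (∃[ z ] (z ∈ U × z ≢ v × z ∉ V)) →
                 ∃[ v ] (Frontier v × Linked (λ z → z ∈ U × z ≢ v))
        choose (yes (z , z∈)) =
          noncut-frontier-of-part W′ (rs (W′⊆W , v , v∈W , v∉W′)) fv v∉W′
            (proj₁ ∘ ∈-comprehension⁻ W′?) (∈-comprehension⁺ W′? z∈) closedW′ rest′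
        choose (no none) = v , fv , linked-via y from-y
          where
          from-y : ∀ {z} → z ∈ U × z ≢ v → Walk (λ z → z ∈ U × z ≢ v) y z
          from-y {z} (z∈U , z≢v) with z ∈? V
          ... | yes z∈V = walk-map (λ u∈ → V⊆U u∈ , V≢v u∈) (walks z∈V)
          ... | no  z∉V = contradiction (z , z∈U , z≢v , z∉V) none

      -- The descent starts from any frontier point `y` and the largest possible part, `U - y`; what
      -- lies outside this part is `y` alone, so it is linked.
      noncut-frontier : ∀ {u} → u ∈ U → ∃[ v ] (Frontier v × Linked (λ z → z ∈ U × z ≢ v))
      noncut-frontier u∈U
        with y , t , y∈U , t∉U , y~t , _ ← exit U (all-linked tt tt) u∈U r∉U
        with any? (λ z → z ∈? U ×-dec ¬? (z ≟ y))
      ... | no none =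
        y , (y∈U , t , t∉U , y~t) , λ { (z∈ , z≢y) _ → contradiction (_ , z∈ , z≢y) none }
      ... | yes (z , z∈U , z≢y) =
        noncut-frontier-of-part (U - y) (⊂-wellFounded _) (y∈U , t , t∉U , y~t)
          (x∉p-x {p = U}) x∈p-y⇒x∈p (x∈p∧x≢y⇒x∈p-y z∈U z≢y) closed (linked-via y from-y)
        where
        closed : ∀ {z u} → z ∈ U - y → u ∈ U → z ~ u → u ≡ y ⊎ u ∈ U - y
        closed {u = u} _ u∈U _ with u ≟ y
        ... | yes eq  = inj₁ eq
        ... | no  u≢y = inj₂ (x∈p∧x≢y⇒x∈p-y u∈U u≢y)

        from-y : ∀ {z} → z ∈ U × z ∉ U - y → Walk (λ z → z ∈ U × z ∉ U - y) y z
        from-y {z} (z∈U , z∉) with z ≟ y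
        ... | yes refl = ε
        ... | no  z≢y  = contradiction (x∈p∧x≢y⇒x∈p-y z∈U z≢y) z∉

  -- The points `u` and `r` keep both sides nonempty. The contraction is assembled in the reverse
  -- order of deletion: `U - y` is contractible by induction, and `y` is added along its rim in `U`,
  -- which is connected by `rim-linked` and lacks the neighbour `t` of `y`.
  region-contractible : ∀ U → Acc _⊂_ U → ∀ {u r} → u ∈ U → r ∉ U →
                        Linked (_∈ U) → Linked (_∉ U) → Contractible (induced H U)
  region-contractible U (acc rs) {u} {r} u∈U r∉U U-linked rest-linked
    with y , (y∈U , t , t∉U , y~t) , noncut ← noncut-frontier U r∉U rest-linked U-linked u∈U
    with any? (λ z → z ∈? U ×-dec ¬? (z ≟ y))
  ... | no none = contractible-point U y∈U only-y
    where
    only-y : ∀ {z} → z ∈ U → z ≡ y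
    only-y {z} z∈U with z ≟ y
    ... | yes eq  = eq
    ... | no  z≢y = contradiction (z , z∈U , z≢y) none
  ... | yes (z , z∈U , z≢y) =
    contractible-extend U X y∈U (∈-comprehension⁻ X?) (λ x∈ e → ∈-comprehension⁺ X? (x∈ , e))
      (region-contractible (U - y) (rs (x∈p⇒p-x⊂p y∈U)) (x∈p∧x≢y⇒x∈p-y z∈U z≢y) (x∉p-x {p = U})
        (linked-resp (λ { (x∈ , x≢y) → x∈p∧x≢y⇒x∈p-y x∈ x≢y })
                     (λ x∈ → x∈p-y⇒x∈p x∈ , x∈p-y⇒x≢y {p = U} x∈) noncut)
        (linked-via t from-t))
      (rim-contractible (U-linked y∈U z∈U))
    where
    X? : ∀ x → Dec (x ∈ U × y ~ x)
    X? x = x ∈? U ×-dec y ~? x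

    X = comprehension X?

    from-t : ∀ {x} → x ∉ U - y → Walk (_∉ U - y) t x
    from-t {x} x∉ with x ≟ y
    ... | yes refl = (t∉U ∘ x∈p-y⇒x∈p , ~-sym y~t , x∉) ◅ ε
    ... | no  x≢y  = walk-map (λ z∉U → z∉U ∘ x∈p-y⇒x∈p)
                       (rest-linked t∉U (λ x∈U → x∉ (x∈p∧x≢y⇒x∈p-y x∈U x≢y)))

    -- The first step of a walk from `y` to another point of `U` shows that the rim in `U` is
    -- nonempty.
    rim-contractible : Walk (_∈ U) y z → Contractible (induced H X)
    rim-contractible ε = contradiction refl z≢y
    rim-contractible ((_ , y~p , p∈U) ◅ _) =
      arc-contractible (rim-cycle y) X (⊂-wellFounded X) (proj₂ ∘ ∈-comprehension⁻ X?)
        (∈-comprehension⁺ X? (p∈U , y~p)) y~t (t∉U ∘ proj₁ ∘ ∈-comprehension⁻ X?)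
        (linked-resp (∈-comprehension⁺ X?) (∈-comprehension⁻ X?)
          (rim-linked U r∉U rest-linked y∈U noncut))

-- A model 1-sphere and the three-point 1-disk cut from it

square : Graph
-- A 4-cycle, as the suspension of a 0-sphere; `outside` keeps the two suspension points
-- nonadjacent.
square = addPoint (addPoint (edgeless 2) full) (outside ∷ full)
  where
  full : Subset 2
  full = inside ∷ inside ∷ []

square-sphere₁ : IsSphere₁ square
square-sphere₁ = cycle⇒sphere₁ embedding-id record
  { nonempty = zero , tt
  ; linked   = linked-via hub λ {x} _ → from-hub x
  ; pairs    = λ {u} _ → pair u
  }
  where
  open Cycles square
  open Graph square using (_~_)

  opposite hub hub′ : Point square
  opposite = suc zero
  hub = suc (suc zero)
  hub′ = suc (suc (suc zero))

  from-hub : ∀ x → Walk (λ _ → ⊤) hub x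
  from-hub zero                   = (tt , there here , tt) ◅ ε
  from-hub (suc zero)             = (tt , here , tt) ◅ ε
  from-hub (suc (suc zero))       = ε
  from-hub (suc (suc (suc zero))) =
    _◅_ {j = zero} (tt , there here , tt) ((tt , there (there here) , tt) ◅ ε)

  full : ∀ (i : Fin 2) → i ∈ inside ∷ inside ∷ []
  full zero       = here
  full (suc zero) = there here

  pair : ∀ u → NonadjacentPair (λ z → ⊤ × u ~ z)
  pair zero = record
    { left = hub ; right = hub′ ; distinct = λ () ; nonadjacent = λ ()
    ; left-∈ = tt , there here ; right-∈ = tt , there (there here)
    ; only = λ { {suc zero} (_ , ()) ; {suc (suc zero)} _ → inj₁ refl
               ; {suc (suc (suc zero))} _ → inj₂ refl } }
  pair (suc zero) = record
    { left = hub ; right = hub′ ; distinct = λ () ; nonadjacent = λ ()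
    ; left-∈ = tt , here ; right-∈ = tt , there here
    ; only = λ { {zero} (_ , ()) ; {suc (suc zero)} _ → inj₁ refl
               ; {suc (suc (suc zero))} _ → inj₂ refl } }
  pair (suc (suc i)) = record
    { left = zero ; right = opposite ; distinct = λ () ; nonadjacent = λ ()
    ; left-∈ = tt , there (full i) ; right-∈ = tt , full i
    ; only = λ { {zero} _ → inj₁ refl ; {suc zero} _ → inj₂ refl ; {suc (suc _)} (_ , ()) } }

module _ (H : Graph) where

  open Graph H using (_~_; ~-sym; ~-irr)
  open Cycles H
  open NonadjacentPair

  -- The path left - x - right is a square without the point opposite to x.
  bent-path-disk₁ : ∀ {x Q A} (π : NonadjacentPair Q) → x ~ left π → x ~ right π →
                    Embedding A H (λ z → z ≡ x ⊎ Q z) → IsDisk₁ A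
  bent-path-disk₁ {x} {Q} π x~l x~r f =
    square , square-sphere₁ , zero , embedding-unique f g
    where
    pick : Fin 3 → Point H
    pick zero             = x
    pick (suc zero)       = left π
    pick (suc (suc zero)) = right π

    g : Embedding (square ∖ ⁅ zero ⁆) H (λ z → z ≡ x ⊎ Q z)
    g = record
      { map⟨_⟩ = pick
      ; injective = λ
          { {zero} {zero} _ → refl
          ; {zero} {suc zero} refl → contradiction x~l (~-irr refl)
          ; {zero} {suc (suc zero)} refl → contradiction x~r (~-irr refl)
          ; {suc zero} {zero} refl → contradiction x~l (~-irr refl)
          ; {suc zero} {suc zero} _ → refl
          ; {suc zero} {suc (suc zero)} eq → contradiction eq (distinct π)
          ; {suc (suc zero)} {zero} refl → contradiction x~r (~-irr refl)
          ; {suc (suc zero)} {suc zero} eq → contradiction (sym eq) (distinct π)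
          ; {suc (suc zero)} {suc (suc zero)} _ → refl }
      ; edge⁺ = λ
          { {zero} {suc zero} _ → x~l
          ; {zero} {suc (suc zero)} _ → x~r
          ; {suc zero} {zero} _ → ~-sym x~l
          ; {suc (suc zero)} {zero} _ → ~-sym x~r }
      ; edge⁻ = λ
          { {zero} {zero} e → contradiction e (~-irr refl)
          ; {zero} {suc zero} _ → here
          ; {zero} {suc (suc zero)} _ → there here
          ; {suc zero} {zero} _ → here
          ; {suc zero} {suc zero} e → ~-irr refl e
          ; {suc zero} {suc (suc zero)} e → nonadjacent π e
          ; {suc (suc zero)} {zero} _ → there here
          ; {suc (suc zero)} {suc zero} e → nonadjacent π (~-sym e)
          ; {suc (suc zero)} {suc (suc zero)} e → ~-irr refl e }
      ; image = λ
          { zero             → inj₁ refl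
          ; (suc zero)       → inj₂ (left-∈ π)
          ; (suc (suc zero)) → inj₂ (right-∈ π) }
      ; covers = covers′
      }
      where
      covers′ : ∀ {z} → z ≡ x ⊎ Q z → ∃[ i ] pick i ≡ z
      covers′ (inj₁ refl) = zero , refl
      covers′ (inj₂ q) with only π q
      ... | inj₁ refl = suc zero , refl
      ... | inj₂ refl = suc (suc zero) , refl

  -- A graph as two subspaces glued along their intersection

  module _ (d e s : Subset (order H)) (s⊆d : s ⊆ d) (s⊆e : s ⊆ e)
           (total : ∀ x → x ∈ d ⊎ x ∈ e) (meet : ∀ {x} → x ∈ d → x ∈ e → x ∈ s)
           (separated : ∀ {x y} → x ∈ d → x ∉ s → y ∈ e → y ∉ s → ¬ (x ~ y)) where

    private
      D = induced H d
      E = induced H e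
      ∂D = restrict d s
      ∂E = restrict e s

      boundary-embedding : ∀ p → s ⊆ p → Embedding (induced (induced H p) (restrict p s)) H (_∈ s)
      boundary-embedding p s⊆p =
        subspace-embedding (induced-embedding H p) (restrict p s)
                           (∈-restrict⁻ p s) s⊆p (∈-restrict⁺ p s)

      fᴰ = boundary-embedding d s⊆d
      fᴱ = boundary-embedding e s⊆e

    boundary-≅ : induced D ∂D ≅ induced E ∂E
    boundary-≅ = embedding-unique fᴰ fᴱ

    private
      Q = glue D ∂D E ∂E boundary-≅

      inner : Fin ∣ ∁ ∂E ∣ → Point H
      inner c = nth e (nth (∁ ∂E) c)

      inner∈e : ∀ c → inner c ∈ e
      inner∈e c = nth-∈ e _

      inner∉s : ∀ c → inner c ∉ s
      inner∉s c c∈s = x∈∁p⇒x∉p (nth-∈ (∁ ∂E) c) (∈-restrict⁺ e s c∈s)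

      place : Point D ⊎ Fin ∣ ∁ ∂E ∣ → Point H
      place (inj₁ x) = nth d x
      place (inj₂ c) = inner c

      place-injective : ∀ a b → place a ≡ place b → a ≡ b
      place-injective (inj₁ x) (inj₁ y) eq = cong inj₁ (nth-injective d eq)
      place-injective (inj₁ x) (inj₂ c) eq =
        contradiction (meet (subst (_∈ d) eq (nth-∈ d x)) (inner∈e c)) (inner∉s c)
      place-injective (inj₂ c) (inj₁ x) eq =
        contradiction (meet (subst (_∈ d) (sym eq) (nth-∈ d x)) (inner∈e c)) (inner∉s c)
      place-injective (inj₂ b) (inj₂ c) eq = cong inj₂ (nth-injective (∁ ∂E) (nth-injective e eq))

      -- The relation that glue uses between a point of D and an interior point of E.
      Across : Point D → Fin ∣ ∁ ∂E ∣ → Set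
      Across x c = ∃[ i ] (nth ∂D i ≡ x × nth e (nth ∂E (_≅_.to boundary-≅ i)) ~ inner c)

      across⁺ : ∀ {x c} → Across x c → nth d x ~ inner c
      across⁺ (i , refl , e) = subst (_~ _) (embedding-unique-commutes fᴰ fᴱ i) e

      across⁻ : ∀ {x c} → nth d x ~ inner c → Across x c
      across⁻ {x} {c} e with nth d x ∈? s
      ... | no  x∉s = contradiction e (separated (nth-∈ d x) x∉s (inner∈e c) (inner∉s c))
      ... | yes x∈s with nth-surjective ∂D (∈-restrict⁺ d s x∈s)
      ...   | i , refl = i , refl , subst (_~ _) (sym (embedding-unique-commutes fᴰ fᴱ i)) e

      g : Embedding Q H (λ _ → ⊤)
      g = record
        { map⟨_⟩    = λ z → place (splitAt (order D) z)
        ; injective = λ {y} {z} eq →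
            trans (sym (join-splitAt (order D) _ y))
              (trans (cong (Fin.join (order D) _) (place-injective (splitAt _ y) (splitAt _ z) eq))
                     (join-splitAt (order D) _ z))
        ; edge⁺     = λ {y} {z} → edge⁺′ y z
        ; edge⁻     = λ {y} {z} → edge⁻′ y z
        ; image     = λ _ → tt
        ; covers    = λ {h} _ → covers′ h
        }
        where
        edge⁺′ : ∀ y z → Graph._~_ Q y z → place (splitAt (order D) y) ~ place (splitAt (order D) z)
        edge⁺′ y z e with splitAt (order D) y | splitAt (order D) z
        ... | inj₁ _ | inj₁ _ = e
        ... | inj₁ _ | inj₂ _ = across⁺ e
        ... | inj₂ _ | inj₁ _ = ~-sym (across⁺ e)
        ... | inj₂ _ | inj₂ _ = e

        edge⁻′ : ∀ y z → place (splitAt (order D) y) ~ place (splitAt (order D) z) → Graph._~_ Q y z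
        edge⁻′ y z e with splitAt (order D) y | splitAt (order D) z
        ... | inj₁ _ | inj₁ _ = e
        ... | inj₁ _ | inj₂ _ = across⁻ e
        ... | inj₂ _ | inj₁ _ = across⁻ (~-sym e)
        ... | inj₂ _ | inj₂ _ = e

        from-d : ∀ {h} → h ∈ d → ∃[ z ] place (splitAt (order D) z) ≡ h
        from-d h∈d with i , refl ← nth-surjective d h∈d =
          i ↑ˡ _ , cong place (splitAt-↑ˡ (order D) i _)

        covers′ : ∀ h → ∃[ z ] place (splitAt (order D) z) ≡ h
        covers′ h with total h
        ... | inj₁ h∈d = from-d h∈d
        ... | inj₂ h∈e with h ∈? s
        ...   | yes h∈s = from-d (s⊆d h∈s)
        ...   | no  h∉s with nth-surjective e h∈e
        ...     | j , refl with nth-surjective (∁ ∂E) (x∉p⇒x∈∁p (h∉s ∘ ∈-restrict⁻ e s))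
        ...       | c , refl = order D ↑ʳ c , cong place (splitAt-↑ʳ (order D) _ c)

    -- The points of the glued graph are placed back in `H`. This map is onto by `total` and
    -- injective by `meet`; by `separated`, an edge from `d` to a point of `e` off `s` starts in
    -- `s`, where `glue` records it.
    glue-cover : H ≅ glue D ∂D E ∂E boundary-≅
    glue-cover = embedding-unique embedding-id g

-- The two disks: the complement of a point and its star

module _ (H : Graph) (manifold : IsManifold₂ H)
         (bound : ∀ S → IsSphere₁ (induced H S) → ∃[ D ] DiskIn H D S) (x : Point H) where

  open Graph H using (_~_; _~?_; ~-sym; ~-irr)
  open Disks H
  open Shelling H manifold bound
  open Cycle
  open NonadjacentPair

  private
    N rest star : Subset (order H)
    N    = neighbours H x
    rest = ∁ ⁅ x ⁆

    star? : ∀ z → Dec (z ≡ x ⊎ x ~ z)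
    star? z = z ≟ x ⊎-dec x ~? z

    star = comprehension star?

    ∈-rest⁺ : ∀ {z} → z ≢ x → z ∈ rest
    ∈-rest⁺ z≢x = x∉p⇒x∈∁p (x≢y⇒x∉⁅y⁆ z≢x)

    ∈-rest⁻ : ∀ {z} → z ∈ rest → z ≢ x
    ∈-rest⁻ z∈ refl = x∈∁p⇒x∉p z∈ (x∈⁅x⁆ x)

    N⊆rest : N ⊆ rest
    N⊆rest z∈ = ∈-rest⁺ λ { refl → ~-irr refl (∈-neighbours⁻ H z∈) }

    N⊆star : N ⊆ star
    N⊆star z∈ = ∈-comprehension⁺ star? (inj₂ (∈-neighbours⁻ H z∈))

    x∈star : x ∈ star
    x∈star = ∈-comprehension⁺ star? (inj₁ refl)

    N-cycle : Cycle (_∈ N)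
    N-cycle = cycle-resp (∈-neighbours⁺ H) (∈-neighbours⁻ H) (rim-cycle x)

    n : Point H
    n = proj₁ (nonempty N-cycle)

    n∈N : n ∈ N
    n∈N = proj₂ (nonempty N-cycle)

    rest-linked : Linked (_∈ rest)
    rest-linked =
      linked-resp (∈-rest⁺ ∘ proj₂) (λ z∈ → tt , ∈-rest⁻ z∈)
        (linked-delete x all-linked (linked-resp (tt ,_) proj₂ (linked (rim-cycle x))))

    -- In the rim of a neighbour a of x, going on from x past the next point b gives
    -- a point adjacent to both a and b, whereas the neighbours of a on the rim of x
    -- are nonadjacent.
    far-point : ∃[ z ] (z ≢ x × ¬ (x ~ z))
    far-point = other (only ρ (~-sym x~a , ~-sym x~b))
      where
      a   = n
      x~a = ∈-neighbours⁻ H n∈N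
      π   = pairs (rim-cycle x) x~a
      b   = left π
      x~b = proj₁ (left-∈ π)
      a~b = proj₂ (left-∈ π)
      ρ   = pairs (rim-cycle a) a~b

      beyond : ∀ {z} → a ~ z → b ~ z → z ≢ x → ∃[ z ] (z ≢ x × ¬ (x ~ z))
      beyond {z} a~z b~z z≢x = z , z≢x , λ x~z → clash (only π (x~z , a~z))
        where
        clash : ¬ (z ≡ left π ⊎ z ≡ right π)
        clash (inj₁ refl) = ~-irr refl b~z
        clash (inj₂ refl) = nonadjacent π b~z

      other : x ≡ left ρ ⊎ x ≡ right ρ → ∃[ z ] (z ≢ x × ¬ (x ~ z))
      other (inj₁ eq) =
        beyond (proj₁ (right-∈ ρ)) (proj₂ (right-∈ ρ)) λ eq′ → distinct ρ (sym (trans eq′ eq))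
      other (inj₂ eq) =
        beyond (proj₁ (left-∈ ρ)) (proj₂ (left-∈ ρ)) λ eq′ → distinct ρ (trans eq′ eq)

    boundary-point : ∀ p {z} → N ⊆ p → z ∈ N → ∃[ i ] i ∈ restrict p N
    boundary-point p N⊆p z∈N with nth-surjective p (N⊆p z∈N)
    ... | i , refl = i , ∈-restrict⁺ p N z∈N

    interior-point : ∀ p {z} → z ∈ p → z ∉ N → ∃[ i ] i ∈ ∁ (restrict p N)
    interior-point p z∈p z∉N with nth-surjective p z∈p
    ... | i , refl = i , x∉p⇒x∈∁p (z∉N ∘ ∈-restrict⁻ p N)

    boundary-is-sphere : ∀ p → N ⊆ p → IsSphere₁ (induced (induced H p) (restrict p N))
    boundary-is-sphere p N⊆p =
      cycle⇒sphere₁ (subspace-embedding (induced-embedding H p) (restrict p N)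
                       (∈-restrict⁻ p N) N⊆p (∈-restrict⁺ p N)) N-cycle

  -- Without `x`, the rim of each neighbour of `x` is a 1-sphere less one point, a 1-disk by
  -- definition, and all other rims are unchanged. The region whose contraction starts here has the
  -- single point `x` as its complement.
  complement-disk : IsDisk₂ (H ∖ ⁅ x ⁆) (restrict rest N)
  complement-disk = record
    { connected         = linked⇒connected f (n , N⊆rest n∈N) rest-linked
    ; contractible      = region-contractible rest (⊂-wellFounded rest) (N⊆rest n∈N)
                            (λ x∈ → ∈-rest⁻ x∈ refl) rest-linked singleton-linked
    ; boundary-nonempty = boundary-point rest N⊆rest n∈N
    ; interior-nonempty =
        let z , z≢x , x≁z = far-point in interior-point rest (∈-rest⁺ z≢x) (x≁z ∘ ∈-neighbours⁻ H)
    ; boundary-rims     = λ i i∈ → punctured-rim i (~-sym (∈-neighbours⁻ H (∈-restrict⁻ rest N i∈)))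
    ; interior-rims     = λ i i∈ →
        whole-rim i (x∈∁p⇒x∉p i∈ ∘ ∈-restrict⁺ rest N ∘ ∈-neighbours⁺ H ∘ ~-sym)
    ; boundary-sphere   = boundary-is-sphere rest N⊆rest
    }
    where
    f = induced-embedding H rest

    singleton-linked : Linked (_∉ rest)
    singleton-linked {a} {b} a∉ b∉ with a ≟ x | b ≟ x
    ... | yes refl | yes refl = ε
    ... | no  a≢x  | _        = contradiction (∈-rest⁺ a≢x) a∉
    ... | _        | no  b≢x  = contradiction (∈-rest⁺ b≢x) b∉

    whole-rim : ∀ i → ¬ (nth rest i ~ x) → IsSphere₁ (rim (H ∖ ⁅ x ⁆) i)
    whole-rim i u≁x =
      cycle⇒sphere₁ (rim-embedding f i)
        (cycle-resp (λ e → ∈-rest⁺ (λ { refl → u≁x e }) , e) proj₂ (rim-cycle (nth rest i)))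

    punctured-rim : ∀ i → nth rest i ~ x → IsDisk₁ (rim (H ∖ ⁅ x ⁆) i)
    punctured-rim i u~x with nth-surjective (neighbours H u) (∈-neighbours⁺ H u~x)
      where u = nth rest i
    ... | j , nth-j = rim H u , proj₂ manifold u , j , embedding-unique (rim-embedding f i) g
      where
      u = nth rest i
      fᵘ = induced-embedding H (neighbours H u)

      is-j : ∀ {k} → nth (neighbours H u) k ≡ x → k ∈ ⁅ j ⁆
      is-j eq = subst (_∈ ⁅ j ⁆) (nth-injective (neighbours H u) (trans nth-j (sym eq))) (x∈⁅x⁆ j)

      g : Embedding (rim H u ∖ ⁅ j ⁆) H (λ z → z ∈ rest × u ~ z)
      g = subspace-embedding fᵘ (∁ ⁅ j ⁆)
            (λ {k} k∈ → ∈-rest⁺ (λ eq → x∈∁p⇒x∉p k∈ (is-j eq)) , ∈-neighbours⁻ H (nth-∈ _ k))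
            (∈-neighbours⁺ H ∘ proj₂)
            (λ { (k∈ , _) → x∉p⇒x∈∁p λ k∈j →
                   ∈-rest⁻ k∈ (trans (cong (nth (neighbours H u)) (x∈⁅y⁆⇒x≡y j k∈j)) nth-j) })

  -- The star is a cone whose only interior point is its apex `x`. The rim of a boundary point
  -- consists of `x` and the two neighbours of that point on the rim of `x`, a path of three points.
  star-disk : IsDisk₂ (induced H star) (restrict star N)
  star-disk = record
    { connected         = linked⇒connected f (x , x∈star) (linked-via x from-x)
    ; contractible      = cone-contractible star (⊂-wellFounded star) x∈star apex
    ; boundary-nonempty = boundary-point star N⊆star n∈N
    ; interior-nonempty = interior-point star x∈star (~-irr refl ∘ ∈-neighbours⁻ H)
    ; boundary-rims     = λ i i∈ → boundary-rim i (∈-neighbours⁻ H (∈-restrict⁻ star N i∈))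
    ; interior-rims     = λ i i∈ → interior-rim i (x∈∁p⇒x∉p i∈ ∘ ∈-restrict⁺ star N ∘ ∈-neighbours⁺ H)
    ; boundary-sphere   = boundary-is-sphere star N⊆star
    }
    where
    f = induced-embedding H star

    apex : ∀ {z} → z ∈ star → z ≢ x → x ~ z
    apex z∈ z≢x with ∈-comprehension⁻ star? z∈
    ... | inj₁ eq = contradiction eq z≢x
    ... | inj₂ e  = e

    from-x : ∀ {z} → z ∈ star → Walk (_∈ star) x z
    from-x z∈ with ∈-comprehension⁻ star? z∈
    ... | inj₁ refl = ε
    ... | inj₂ e    = (x∈star , e , z∈) ◅ ε

    boundary-rim : ∀ i → x ~ nth star i → IsDisk₁ (rim (induced H star) i)
    boundary-rim i x~u =
      bent-path-disk₁ H π (proj₁ (left-∈ π)) (proj₁ (right-∈ π))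
        (embedding-resp to from (rim-embedding f i))
      where
      u = nth star i
      π = pairs (rim-cycle x) x~u

      to : ∀ {z} → z ∈ star × u ~ z → z ≡ x ⊎ (x ~ z × u ~ z)
      to (z∈ , e) with ∈-comprehension⁻ star? z∈
      ... | inj₁ eq  = inj₁ eq
      ... | inj₂ x~z = inj₂ (x~z , e)

      from : ∀ {z} → z ≡ x ⊎ (x ~ z × u ~ z) → z ∈ star × u ~ z
      from (inj₁ refl)      = x∈star , ~-sym x~u
      from (inj₂ (x~z , e)) = ∈-comprehension⁺ star? (inj₂ x~z) , e

    interior-rim : ∀ i → ¬ (x ~ nth star i) → IsSphere₁ (rim (induced H star) i)
    interior-rim i x≁u with ∈-comprehension⁻ star? (nth-∈ star i)
    ... | inj₂ x~u = contradiction x~u x≁u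
    ... | inj₁ u≡x =
      cycle⇒sphere₁ (rim-embedding f i)
        (cycle-resp (λ e → ∈-comprehension⁺ star? (inj₂ (subst (_~ _) u≡x e)) , e) proj₂
                    (rim-cycle (nth star i)))

  star-glued-to-complement : IsSphere₂ H
  star-glued-to-complement =
    H ∖ ⁅ x ⁆ , restrict rest N , induced H star , restrict star N , complement-disk , star-disk ,
    boundary-≅ H rest star N N⊆rest N⊆star total meet separated ,
    glue-cover H rest star N N⊆rest N⊆star total meet separated
    where
    total : ∀ z → z ∈ rest ⊎ z ∈ star
    total z with z ≟ x
    ... | yes refl = inj₂ x∈star
    ... | no  z≢x  = inj₁ (∈-rest⁺ z≢x)

    meet : ∀ {z} → z ∈ rest → z ∈ star → z ∈ N
    meet z∈rest z∈star with ∈-comprehension⁻ star? z∈star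
    ... | inj₁ eq = contradiction eq (∈-rest⁻ z∈rest)
    ... | inj₂ e  = ∈-neighbours⁺ H e

    -- The only point of the star off `N` is `x`, and all neighbours of `x` are in `N`.
    separated : ∀ {y z} → y ∈ rest → y ∉ N → z ∈ star → z ∉ N → ¬ (y ~ z)
    separated _ y∉N z∈ z∉N e with ∈-comprehension⁻ star? z∈
    ... | inj₁ refl = y∉N (∈-neighbours⁺ H (~-sym e))
    ... | inj₂ x~z  = z∉N (∈-neighbours⁺ H x~z)

theorem8p1 : (H : Graph) → IsManifold₂ H →
    ((K : Graph) → IsManifold₂ K → Equivalent H K →
    (S : Subset (Graph.order K)) → IsSphere₁ (induced K S) →
    ∃[ D ] DiskIn K D S) →
    IsSphere₂ H
theorem8p1 H manifold bound =
  -- The empty sequence of d-transformations gives the case of `K` equal to `H`. The deleted point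
  -- is the one that the connectedness of `H` provides.
  star-glued-to-complement H manifold (bound H manifold (inj₁ ε)) (proj₁ (proj₁ manifold))
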